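{- The family of uniformly recurrent tree sets is closed under maximal bifix decoding. That is: let $A$ be a finite alphabet, let $S\subset A^*$ be a uniformly recurrent tree set, let $Z\subset S$ be a finite $S$-maximal bifix code, and let $f:B^*\to A^*$ be a coding morphism for $Z$. Then $f^{ -1}(S)\subset B^*$ is a uniformly recurrent tree set.
   Context: Words and sets. $A$ is a finite nonempty alphabet, $A^*$ the free monoid of finite words over $A$, $A^+$ the set of nonempty words, and $1$ (or $\varepsilon$) the empty word. A set $S$ of words is factorial if it contains all factors of its elements. A factorial set $S$ is right-extendable if for every $w\in S$ there is a letter $a$ with $wa\in S$, and biextendable if for every $w\in S$ there are letters $a,b$ with $awb\in S$. A set $S$ is uniformly recurrent if it is (nonempty) factorial and right-extendable and for every $u\in S$ there is $n\ge 1$ such that $u$ is a factor of every word of $S$ of length $n$. Tree sets. For a factorial set $S$ and $w\in S$, let $L(w)=\{a\in A\mid aw\in S\}$, $R(w)=\{a\in A\mid wa\in S\}$, $E(w)=\{(a,b)\in A\times A\mid awb\in S\}$. The extension graph $G(w)$ is the undirected graph whose vertex set is the disjoint union of $L(w)$ and $R(w)$ and whose edges are the pairs $(a,b)\in E(w)$ (joining $a\in L(w)$ to $b\in R(w)$). $S$ is a tree set if it is factorial, biextendable, and for every $w\in S$ (including the empty word) the graph $G(w)$ is a tree, i.e. connected and acyclic. Codes. A prefix code is a set of nonempty words containing no proper prefix of any of its elements; a suffix code is defined symmetrically; a bifix code is both a prefix code and a suffix code. A bifix code $Z\subset S$ is $S$-maximal if it is not properly contained in any bifix code $Z'\subset S$.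 A coding morphism for a code $Z\subset A^+$ is a monoid morphism $f:B^*\to A^*$ which maps the alphabet $B$ bijectively onto $Z$. If $f$ is a coding morphism for a finite $S$-maximal bifix code, $f^{ -1}(S)$ is called a maximal bifix decoding of $S$. -}

module Defs where

open import Level using (0ℓ)
open import Algebra.Morphism.Structures using (module MonoidMorphisms)
open import Data.Fin.Base using (Fin)
open import Data.List.Base using (List; []; _∷_; [_]; _∷ʳ_; length; ++-[]-rawMonoid)
open import Data.List.Membership.Propositional using () renaming (_∈_ to _∈ˡ_)
open import Data.List.Relation.Binary.Infix.Heterogeneous using (Infix)
open import Data.List.Relation.Binary.Prefix.Heterogeneous using (Prefix)
open import Data.List.Relation.Binary.Suffix.Heterogeneous using (Suffix)
open import Data.List.Relation.Unary.Linked using (Linked)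
open import Data.List.Relation.Unary.Unique.Propositional using (Unique)
open import Data.Nat.Base using (_≤_) renaming (suc to 1+_)
open import Data.Product.Base using (∃-syntax; _×_)
open import Data.Sum.Base using (_⊎_; inj₁; inj₂; [_,_])
open import Function.Bundles using (_↔_)
open import Function.Definitions using (Injective)
open import Relation.Binary.Construct.Closure.ReflexiveTransitive using (Star)
open import Relation.Binary.Core using (Rel)
open import Relation.Binary.PropositionalEquality.Core using (_≡_; _≢_)
open import Relation.Nullary.Negation.Core using (¬_)
open import Relation.Unary using (Pred; _∈_; _⊆_; _⊂_; _≐_; Satisfiable)

FiniteNonempty : Set → Set
FiniteNonempty A = ∃[ n ] (A ↔ Fin (1+ n))

Word : Set → Set
Word A = List A

WordSet : Set → Set₁
WordSet A = Pred (Word A) 0ℓ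

-- Factors, prefixes and suffixes, the whole word and the empty word included.
module _ {A : Set} where

  _isFactorOf_ _isPrefixOf_ _isSuffixOf_ : Rel (Word A) 0ℓ
  _isFactorOf_ = Infix _≡_
  _isPrefixOf_ = Prefix _≡_
  _isSuffixOf_ = Suffix _≡_

  _isProperPrefixOf_ _isProperSuffixOf_ : Rel (Word A) 0ℓ
  u isProperPrefixOf w = u isPrefixOf w × u ≢ w
  u isProperSuffixOf w = u isSuffixOf w × u ≢ w

  Finite : WordSet A → Set
  Finite Z = ∃[ ws ] (Z ≐ (_∈ˡ ws))

-- An undirected graph whose vertex set is a subset of the type V.  Vertices
-- are singled out by a predicate, not a Σ-type, so that a vertex is counted
-- once however many proofs of membership it has.
record Graph (V : Set) : Set₁ where
  field
    Vertex   : Pred V 0ℓ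
    Adjacent : Rel V 0ℓ

module _ {V : Set} (G : Graph V) where
  open Graph G

  Connected : Set
  Connected = ∀ {x y} → x ∈ Vertex → y ∈ Vertex → Star Adjacent x y

  -- The closed walk x, v₁, …, vₖ, x with x, v₁, …, vₖ distinct and k ≥ 2.
  IsCycle : V → List V → Set
  IsCycle x vs = 2 ≤ length vs × Unique (x ∷ vs) × Linked Adjacent (x ∷ vs ∷ʳ x)

  Acyclic : Set
  Acyclic = ∀ x vs → ¬ IsCycle x vs

  IsTree : Set
  IsTree = Connected × Acyclic

module _ {A : Set} (S : WordSet A) where

  Factorial : Set
  Factorial = ∀ {u w} → w ∈ S → u isFactorOf w → u ∈ S

  RightExtendable : Set
  RightExtendable = ∀ {w} → w ∈ S → ∃[ a ] (w ∷ʳ a ∈ S)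

  Biextendable : Set
  Biextendable = ∀ {w} → w ∈ S → ∃[ a ] ∃[ b ] (a ∷ w ∷ʳ b ∈ S)

  record UniformlyRecurrent : Set where
    field
      nonempty        : Satisfiable S
      factorial       : Factorial
      rightExtendable : RightExtendable
      recurrence      : ∀ {u} → u ∈ S →
                        ∃[ n ] (1 ≤ n × (∀ {w} → w ∈ S → length w ≡ n → u isFactorOf w))

  L R : Word A → Pred A 0ℓ
  L w a = a ∷ w ∈ S
  R w a = w ∷ʳ a ∈ S

  E : Word A → A → A → Set
  E w a b = a ∷ w ∷ʳ b ∈ S

  data ExtensionEdge (w : Word A) : Rel (A ⊎ A) 0ℓ where
    left-right : ∀ {a b} → E w a b → ExtensionEdge w (inj₁ a) (inj₂ b)
    right-left : ∀ {a b} → E w a b → ExtensionEdge w (inj₂ b) (inj₁ a)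

  -- When S is factorial, the endpoints of every edge are vertices.
  extensionGraph : Word A → Graph (A ⊎ A)
  extensionGraph w = record
    { Vertex   = [ L w , R w ]
    ; Adjacent = ExtensionEdge w
    }

  record TreeSet : Set where
    field
      factorial    : Factorial
      biextendable : Biextendable
      tree         : ∀ {w} → w ∈ S → IsTree (extensionGraph w)

module _ {A : Set} (Z : WordSet A) where

  record PrefixCode : Set where
    field
      nonemptyWords  : ∀ {z} → z ∈ Z → z ≢ []
      noProperPrefix : ∀ {u z} → u ∈ Z → z ∈ Z → ¬ (u isProperPrefixOf z)

  record SuffixCode : Set where
    field
      nonemptyWords  : ∀ {z} → z ∈ Z → z ≢ []
      noProperSuffix : ∀ {u z} → u ∈ Z → z ∈ Z → ¬ (u isProperSuffixOf z)

  BifixCode : Set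
  BifixCode = PrefixCode × SuffixCode

-- Here _⊂_ is strict inclusion.
record MaximalBifixCode {A : Set} (S Z : WordSet A) : Set₁ where
  field
    contained : Z ⊆ S
    bifix     : BifixCode Z
    maximal   : ¬ (∃[ Z′ ] (Z′ ⊆ S × BifixCode Z′ × Z ⊂ Z′))

-- That f maps the letters of B bijectively onto Z is expressed by injectivity
-- on letters and image Z; a bijection B → Σ (Word A) Z would distinguish
-- different membership proofs for the same word.
record CodingMorphism {A B : Set} (Z : WordSet A) (f : Word B → Word A) : Set where
  open MonoidMorphisms (++-[]-rawMonoid B) (++-[]-rawMonoid A)
  field
    isMonoidHomomorphism : IsMonoidHomomorphism f
    lettersInjective     : Injective _≡_ _≡_ (λ (b : B) → f [ b ])
    lettersInto          : ∀ b → f [ b ] ∈ Z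
    lettersOnto          : ∀ {z} → z ∈ Z → ∃[ b ] (f [ b ] ≡ z)

{-# OPTIONS --safe #-}
module Submission where

-- Call the words f [ b ] codewords.  If some long word w of S had no codeword as
-- a prefix, then by maximality every long word of S would have one as a suffix.
-- Decoding backward from many occurrences of w in one word of S then produces, by
-- the pigeonhole principle, a codeword starting at an occurrence of w.  Hence, and by
-- reversal, all long words of S start and end with a codeword.
--
-- The extension graph of w in f⁻¹(S) has the edges (b , b′) such that
-- f [ b ] ++ f w ++ f [ b′ ] lies in S.  It arises from extension graphs of S by
-- repeatedly splitting a vertex σ into the vertices aσ, whose edges to the
-- neighbours of σ form a tree; this preserves trees.
--
-- Since extension graphs of f⁻¹(S) are connected, any two words of f⁻¹(S) of length
-- at least n are joined by a path of such words in which neighbours are factors of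
-- each other.  Given u in f⁻¹(S), consider a word l ++ r of S and the set of
-- positions i of r such that a factorisation into codewords cutting r at i is forced
-- to read u.  If i is not in this set, a path from a factorisation through i to a
-- word containing u meets a word that contains u and cuts some occurrence of l ++ r
-- at a position not in the set, so that l ++ r extends to a word with a larger set.
-- Once the set is full, the recurrence of l ++ r in S gives that of u in f⁻¹(S).
-- Membership in S need not be decidable, so that the length bound has to be
-- extracted from this process and not from a compactness argument.

open import Defs
open import Algebra.Morphism.Structures using (module MonoidMorphisms)
open import Data.Empty using (⊥; ⊥-elim)
open import Data.Fin.Base as Fin using (Fin; zero; suc; toℕ; fromℕ<)
open import Data.Fin.Properties using (pigeonhole; toℕ-fromℕ<; toℕ≤pred[n]; inj⇒≟)
open import Data.List.Base
  using (List; []; _∷_; [_]; _++_; _∷ʳ_; length; reverse; take; drop; allFin)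
open import Data.List.Properties
  using (++-assoc; ++-identityʳ; ++-cancelˡ; length-++; length-++-≤ˡ; length-++-≤ʳ;
         reverse-++; reverse-involutive; reverse-injective; length-reverse; unfold-reverse;
         ∷-injective; ∷ʳ-injectiveˡ; length-take; take++drop≡id)
open import Data.List.Membership.Propositional using (find; lose) renaming (_∈_ to _∈ˡ_)
open import Data.List.Membership.Propositional.Properties using (∈-∃++; ∈-allFin)
import Data.List.Relation.Binary.Infix.Heterogeneous as Infix
open import Data.List.Relation.Binary.Pointwise using (Pointwise-≡⇒≡; ≡⇒Pointwise-≡)
import Data.List.Relation.Binary.Prefix.Heterogeneous as Prefix
import Data.List.Relation.Binary.Prefix.Heterogeneous.Properties as Prefix
open import Data.List.Relation.Binary.Prefix.Heterogeneous.Properties using (prefix?)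
import Data.List.Relation.Binary.Suffix.Heterogeneous as Suffix
import Data.List.Relation.Binary.Suffix.Heterogeneous.Properties as Suffix
open import Data.List.Relation.Binary.Suffix.Heterogeneous.Properties using (suffix?)
open import Data.List.Relation.Unary.All as All using (All; []; _∷_)
import Data.List.Relation.Unary.All.Properties as All
open import Data.List.Relation.Unary.AllPairs as AllPairs using ([]; _∷_)
import Data.List.Relation.Unary.AllPairs.Properties as AllPairs
open import Data.List.Relation.Unary.Any using (Any; any?; here; there)
open import Data.List.Relation.Unary.Linked as Linked using (Linked; [-]; _∷_)
open import Data.List.Relation.Unary.Unique.Propositional using (Unique)
open import Data.Nat.Base using (ℕ; zero; suc; _+_; _≤_; _<_; z≤n; s≤s; z<s; s<s)
open import Data.Nat.Properties
  using (≤-refl; ≤-reflexive; ≤-trans; ≤-total; <-irrefl; ≤-<-trans; m≤m+n; m≤n+m;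
         +-suc; +-comm; suc-injective; _<?_; ≮⇒≥; <⇒≱; n<1+n; <⇒≤; m≤n⇒m⊓n≡m)
open import Data.Product.Base using (∃-syntax; _×_; _,_; proj₁; proj₂)
open import Data.Sum.Base using (_⊎_; inj₁; inj₂; [_,_]′)
open import Data.Unit.Base using (⊤; tt)
open import Function.Base using (_∘_; id; flip)
open import Function.Properties.Inverse using (↔⇒↣)
open import Relation.Binary.Construct.Closure.ReflexiveTransitive as Star
  using (Star; ε; _◅_; _◅◅_; kleisliStar)
open import Relation.Binary.Definitions using (DecidableEquality)
open import Relation.Binary.PropositionalEquality
  using (_≡_; _≢_; refl; sym; trans; cong; cong₂; subst; subst₂; module ≡-Reasoning)
open import Relation.Nullary.Decidable using (Dec; yes; no; map′)
open import Relation.Nullary.Negation using (¬_; contradiction)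
open import Relation.Unary using (_⊢_)

-- Prefixes, suffixes and factors as equations between words

infix 4 _≼_ _≽_ _⊑_

_≼_ _≽_ _⊑_ : {A : Set} → Word A → Word A → Set
u ≼ w = ∃[ t ] (w ≡ u ++ t)
u ≽ w = ∃[ t ] (w ≡ t ++ u)
u ⊑ w = ∃[ l ] ∃[ r ] (w ≡ l ++ u ++ r)

module _ {A : Set} where

  ⊑-refl : {u : Word A} → u ⊑ u
  ⊑-refl {u} = [] , [] , sym (++-identityʳ u)

  ⊑-trans : {u v w : Word A} → u ⊑ v → v ⊑ w → u ⊑ w
  ⊑-trans {u} (l , r , refl) (l′ , r′ , refl) = l′ ++ l , r ++ r′ , (begin
    l′ ++ (l ++ u ++ r) ++ r′   ≡⟨ cong (l′ ++_) (++-assoc l (u ++ r) r′) ⟩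
    l′ ++ l ++ (u ++ r) ++ r′   ≡⟨ cong (λ z → l′ ++ l ++ z) (++-assoc u r r′) ⟩
    l′ ++ l ++ u ++ r ++ r′     ≡⟨ ++-assoc l′ l (u ++ r ++ r′) ⟨
    (l′ ++ l) ++ u ++ r ++ r′   ∎)
    where open ≡-Reasoning

  ≼⇒⊑ : {u w : Word A} → u ≼ w → u ⊑ w
  ≼⇒⊑ (t , eq) = [] , t , eq

  ≽⇒⊑ : {u w : Word A} → u ≽ w → u ⊑ w
  ≽⇒⊑ {u} (t , eq) = t , [] , trans eq (cong (t ++_) (sym (++-identityʳ u)))

  ++ˡ⊑ : (u v : Word A) → u ⊑ u ++ v
  ++ˡ⊑ u v = [] , v , refl

  ++ʳ⊑ : (u v : Word A) → v ⊑ u ++ v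
  ++ʳ⊑ u v = ≽⇒⊑ (u , refl)

  reverse-⊑ : {u w : Word A} → u ⊑ w → reverse u ⊑ reverse w
  reverse-⊑ {u} (l , r , refl) = reverse r , reverse l , (begin
    reverse (l ++ u ++ r)                   ≡⟨ reverse-++ l (u ++ r) ⟩
    reverse (u ++ r) ++ reverse l           ≡⟨ cong (_++ reverse l) (reverse-++ u r) ⟩
    (reverse r ++ reverse u) ++ reverse l   ≡⟨ ++-assoc (reverse r) (reverse u) (reverse l) ⟩
    reverse r ++ reverse u ++ reverse l     ∎)
    where open ≡-Reasoning

  reverse-≼ : {u w : Word A} → u ≼ w → reverse u ≽ reverse w
  reverse-≼ {u} (t , refl) = reverse t , reverse-++ u t

  reverse-≽ : {u w : Word A} → u ≽ w → reverse u ≼ reverse w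
  reverse-≽ {u} (t , refl) = reverse t , reverse-++ t u

  levi : (a c : Word A) {b d : Word A} → a ++ b ≡ c ++ d → length a ≤ length c →
         ∃[ t ] (c ≡ a ++ t × b ≡ t ++ d)
  levi []      c       eq _        = c , refl , eq
  levi (x ∷ a) (y ∷ c) eq (s≤s le) with ∷-injective eq
  ... | refl , eq′ with levi a c eq′ le
  ...   | t , refl , eq″ = t , refl , eq″

  ++-injective : (a c : Word A) {b d : Word A} → a ++ b ≡ c ++ d → length a ≡ length c →
                 a ≡ c × b ≡ d
  ++-injective []      []      eq _ = refl , eq
  ++-injective (x ∷ a) (y ∷ c) eq l with ∷-injective eq
  ... | refl , eq′ with ++-injective a c eq′ (suc-injective l)
  ...   | refl , eq″ = refl , eq″

  cons≡snoc : ∀ (a : A) w → ∃[ v ] ∃[ b ] (a ∷ w ≡ v ∷ʳ b)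
  cons≡snoc a []      = [] , a , refl
  cons≡snoc a (x ∷ w) = let v , b , eq = cons≡snoc x w in a ∷ v , b , cong (a ∷_) eq

  nonempty⇒shorter : (t : Word A) {u : Word A} → u ≢ [] → length t < length (t ++ u)
  nonempty⇒shorter []      {[]}    ne = contradiction refl ne
  nonempty⇒shorter []      {_ ∷ _} ne = z<s
  nonempty⇒shorter (x ∷ t)         ne = s<s (nonempty⇒shorter t ne)

  nonempty⇒shorterʳ : (u : Word A) {t : Word A} → u ≢ [] → length t < length (u ++ t)
  nonempty⇒shorterʳ []      ne = contradiction refl ne
  nonempty⇒shorterʳ (x ∷ u) ne = s≤s (length-++-≤ʳ _ {u})

-- Bipartite graphs

module _ {X Y : Set} (E : X → Y → Set) where

  -- A walk y, x, …, y′ without backtracking.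
  data Trail : Y → X → Y → Set where
    edges : ∀ {x y y′} → E x y → E x y′ → y ≢ y′ → Trail y x y′
    cons  : ∀ {x x′ y y′ y″} → E x y → E x y′ → y ≢ y′ → x ≢ x′ → Trail y′ x′ y″ → Trail y x y″

  -- A closed trail may turn back at its base point `y`, so more than cycles is excluded here; in an
  -- acyclic graph such walks are impossible as well.
  Forest : Set
  Forest = ∀ {y x} → ¬ Trail y x y

  Link : Y → Y → Set
  Link y y′ = ∃[ x ] (E x y × E x y′)

  -- Only vertices that lie on an edge are compared, so that no vertex set has to be carried through
  -- the refinement.
  EdgeConnected : Set
  EdgeConnected = ∀ {x y x′ y′} → E x y → E x′ y′ → Star Link y y′

module _ {X Y : Set} {E : X → Y → Set} where

  firstEdge : ∀ {y x y′} → Trail E y x y′ → E x y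
  firstEdge (edges e _ _)    = e
  firstEdge (cons e _ _ _ _) = e

  map-Trail : {E′ : X → Y → Set} → (∀ {x y} → E x y → E′ x y) →
              ∀ {y x y′} → Trail E y x y′ → Trail E′ y x y′
  map-Trail g (edges e e′ y≢)     = edges (g e) (g e′) y≢
  map-Trail g (cons e e′ y≢ x≢ t) = cons (g e) (g e′) y≢ x≢ (map-Trail g t)

  -- Here `z` is the last vertex in `Y` before `x′`. The trail between two vertices of `X` gets `y₀`
  -- in front and is cut at `z`; any edge at `x′` other than the one to `z` continues it.
  unflip-Trail : ∀ {x y x′ y₀} → E x y₀ → Trail (flip E) x y x′ → y₀ ≢ y →
                 ∃[ z ] (E x′ z × Trail E y₀ x z ×
                         (∀ {y′} → E x′ y′ → z ≢ y′ → Trail E y₀ x y′))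
  unflip-Trail e₀ (edges {x = y} e e′ x≢) y₀≢ =
    y , e′ , edges e₀ e y₀≢ , λ e″ y≢ → cons e₀ e y₀≢ x≢ (edges e′ e″ y≢)
  unflip-Trail e₀ (cons e e′ x≢ y≢ t) y₀≢ =
    let z , ez , t′ , close = unflip-Trail e′ t y≢
    in z , ez , cons e₀ e y₀≢ x≢ t′ , λ e″ z≢ → cons e₀ e y₀≢ x≢ (close e″ z≢)

  -- A closed trail at `x` is opened at its first vertex `y` in `Y`. It comes back to `x` from some
  -- `z`: if `z` is `y`, the part from `y` to `z` is closed already, and otherwise the edge between
  -- `x` and `y` closes it.
  flip-Forest : Forest E → Forest (flip E)
  flip-Forest forest (edges _ _ x≢)       = x≢ refl
  flip-Forest forest (cons e e′ x≢ y≢ t) =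
    let z , ez , t′ , close = unflip-Trail e′ t y≢
    in forest (close e λ z≡y → forest (subst (Trail E _ _) z≡y t′))

  flip-EdgeConnected : EdgeConnected E → EdgeConnected (flip E)
  flip-EdgeConnected connected e e′ = go e (connected e e′) e′
    where
    go : ∀ {x y x′ y′} → E x y → Star (Link E) y y′ → E x′ y′ → Star (Link (flip E)) x x′
    go e ε                    e′ = (_ , e , e′) ◅ ε
    go e ((x , ey , ez) ◅ s) e′ = (_ , e , ey) ◅ go ez s e′

module _ {X Y : Set} {E E′ : X → Y → Set} where

  map-Forest : (∀ {x y} → E′ x y → E x y) → Forest E → Forest E′
  map-Forest g forest t = forest (map-Trail g t)

  map-EdgeConnected : (∀ {x y} → E x y → E′ x y) → (∀ {x y} → E′ x y → E x y) →
                      EdgeConnected E → EdgeConnected E′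
  map-EdgeConnected g h connected e e′ =
    Star.map (λ (_ , e , e′) → _ , g e , g e′) (connected (h e) (h e′))

-- Contracting the fibres of a bipartite graph

module _ {X X̄ Y : Set} {E : X → Y → Set} {Ē : X̄ → Y → Set}
         (_≟_ : DecidableEquality X̄) (π : X → X̄)
         (project : ∀ {x y} → E x y → Ē (π x) y) where

  Fibre : X̄ → X → Y → Set
  Fibre x̄ x y = E x y × π x ≡ x̄

  module _ (fibres : ∀ x̄ → Forest (Fibre x̄)) where

    contract-fibre : ∀ {x̄ y x z} → Trail (Fibre x̄) y x z → Ē x̄ y × Ē x̄ z × y ≢ z
    contract-fibre t = project′ (firstEdge t) , end t , λ { refl → fibres _ t }
      where
      project′ : ∀ {x̄ x y} → Fibre x̄ x y → Ē x̄ y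
      project′ (e , refl) = project e
      end : ∀ {x̄ y x z} → Trail (Fibre x̄) y x z → Ē x̄ z
      end (edges _ e _)    = project′ e
      end (cons _ _ _ _ t) = end t

    -- What follows an initial part inside the fibre of `x̄`, after contraction: nothing, or a trail
    -- through a vertex other than `x̄`, so that joining the two does not backtrack.
    Remainder : X̄ → Y → Y → Set
    Remainder x̄ y z = y ≡ z ⊎ ∃[ x̄′ ] (x̄ ≢ x̄′ × Trail Ē y x̄′ z)

    contract-initial : ∀ {x̄ y x y′ z} → Trail (Fibre x̄) y x y′ → Remainder x̄ y′ z → Trail Ē y x̄ z
    contract-initial t rest with contract-fibre t | rest
    ... | e , e′ , y≢ | inj₁ refl          = edges e e′ y≢
    ... | e , e′ , y≢ | inj₂ (_ , x̄≢ , t′) = cons e e′ y≢ x̄≢ t′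

    -- The maximal initial part of a trail inside one fibre does not close up,
    -- so that contracting the fibres yields a trail again.
    splitInitial : ∀ {y x z} → Trail E y x z →
                   ∃[ y′ ] (Trail (Fibre (π x)) y x y′ × Remainder (π x) y′ z)
    splitInitial (edges {y′ = y′} e e′ y≢) = y′ , edges (e , refl) (e′ , refl) y≢ , inj₁ refl
    splitInitial (cons {x} {x′} {y′ = y′} e e′ y≢ x≢ t) with splitInitial t | π x ≟ π x′
    ... | z , t₁ , rest | yes p = z ,
      cons (e , refl) (e′ , refl) y≢ x≢ (map-Trail (λ (d , q) → d , trans q (sym p)) t₁) ,
      subst (λ x̄ → Remainder x̄ z _) (sym p) rest
    ... | z , t₁ , rest | no πx≢ = y′ , edges (e , refl) (e′ , refl) y≢ ,
      inj₂ (π x′ , πx≢ , contract-initial t₁ rest)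

    contract-Forest : Forest Ē → Forest E
    contract-Forest forest t =
      let _ , t₁ , rest = splitInitial t in forest (contract-initial t₁ rest)

-- Passing from the next letter after q to the codeword c b above q splits a
-- vertex of a bipartite graph along the trie of the code.  One level of the trie
-- is treated at a time, by induction on M minus the length of q.
module Refinement {A B Y : Set} (_≟_ : DecidableEquality A) (c : B → Word A) (M : ℕ)
  (bounded : ∀ b → length (c b) ≤ M)
  (prefixFree : ∀ {b b′ t} → c b′ ≡ c b ++ t → b ≡ b′)
  (F : Word A → Y → Set) where

  _above_ : (B → Y → Set) → Word A → B → Y → Set
  (E above q) b y = E b y × q ≼ c b

  short : ∀ q {b a s} → c b ≡ q ++ a ∷ s → ¬ (M ≤ length q)
  short q {b} {a} {s} cb≡ M≤q = <⇒≱ (subst (length q <_) (cong length (sym cb≡))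
    (nonempty⇒shorter q λ ())) (≤-trans (bounded b) M≤q)

  suc-shift : ∀ {k} q (a : A) → M ≤ suc k + length q → M ≤ k + length (q ∷ʳ a)
  suc-shift {k} q a = subst (M ≤_) (sym (trans (cong (k +_) (trans (length-++ q) (+-comm _ 1)))
    (+-suc k (length q))))

  ∷ʳ-≼ : ∀ {q a s} {w : Word A} → w ≡ q ++ a ∷ s → q ∷ʳ a ≼ w
  ∷ʳ-≼ {q} {a} {s} eq = s , trans eq (sym (++-assoc q [ a ] s))

  G : B → Y → Set
  G b y = F (c b) y

  module _ (prefixClosed : ∀ q {t y} → F (q ++ t) y → F q y)
           (forest : ∀ q → Forest (λ a y → F (q ∷ʳ a) y)) where

    -- junk value a if w is not longer than q
    letterAfter : A → Word A → Word A → A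
    letterAfter a []      []      = a
    letterAfter a []      (x ∷ w) = x
    letterAfter a (_ ∷ q) []      = a
    letterAfter a (_ ∷ q) (_ ∷ w) = letterAfter a q w

    letterAfter-≡ : ∀ a q {x s w} → w ≡ q ++ x ∷ s → letterAfter a q w ≡ x
    letterAfter-≡ a []      refl = refl
    letterAfter-≡ a (_ ∷ q) refl = letterAfter-≡ a q refl

    -- If `q` is itself a codeword, prefix-freeness makes `b` the only vertex above `q`, so a trail
    -- has no second vertex to move to.
    singleton : ∀ {q b y y′} → c b ≡ q → Trail (G above q) y b y′ → y ≢ y′
    singleton _    (edges _ _ y≢)      = y≢
    singleton refl (cons _ _ _ b≢ t) = contradiction (prefixFree (proj₂ (proj₂ (firstEdge t)))) b≢

    -- Either `q` is a codeword, or all codewords above `q` continue with a letter. Contracting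
    -- along that letter gives the graph of next letters after `q`, a forest by hypothesis; the
    -- fibres are the graphs above `q ∷ʳ x`, forests by induction.
    forest-above : ∀ k q → M ≤ k + length q → Forest (G above q)
    forest-above k q M≤ t with firstEdge t
    ... | e , [] , cb≡ = singleton (trans cb≡ (++-identityʳ q)) t refl
    forest-above zero    q M≤ t | e , a ∷ s , cb≡ = short q cb≡ M≤
    forest-above (suc k) q M≤ t | e , a ∷ s , cb≡ =
      contract-Forest _≟_ letter project fibres (forest q) (map-Trail proper t)
      where
      letter = λ b → letterAfter a q (c b)
      G⁺ : B → Y → Set
      G⁺ b y = G b y × ∃[ x ] ∃[ r ] (c b ≡ q ++ x ∷ r)
      proper : ∀ {b y} → (G above q) b y → G⁺ b y
      proper (e , x ∷ r , eq) = e , x , r , eq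
      -- A codeword equal to `q` would be identified with the first codeword of the trail, whose
      -- decomposition then serves.
      proper (e , [] , eq) with prefixFree (trans cb≡ (cong (_++ a ∷ s) (sym (trans eq (++-identityʳ q)))))
      ... | refl = e , a , s , cb≡
      project : ∀ {b y} → G⁺ b y → F (q ∷ʳ letter b) y
      project {b} {y} (e , x , r , eq) = subst (λ z → F (q ∷ʳ z) y) (sym (letterAfter-≡ a q eq))
        (prefixClosed (q ∷ʳ x) (subst (λ z → F z y) (proj₂ (∷ʳ-≼ {q} eq)) e))
      fibres : ∀ x → Forest (Fibre {E = G⁺} {Ē = λ a y → F (q ∷ʳ a) y} _≟_ letter project x)
      fibres x t = forest-above k (q ∷ʳ x) (suc-shift q x M≤) (map-Trail in-fibre t)
        where
        in-fibre : ∀ {b y} → G⁺ b y × letter b ≡ x → (G above (q ∷ʳ x)) b y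
        in-fibre ((e , _ , _ , eq) , refl) with letterAfter-≡ a q eq
        ... | p = e , ∷ʳ-≼ {q} (trans eq (cong (λ z → q ++ z ∷ _) (sym p)))

    refine-Forest : Forest G
    refine-Forest t = forest-above M [] (m≤m+n M 0) (map-Trail (λ e → e , _ , refl) t)

  module _ (prefixClosed : ∀ q {t y} → F (q ++ t) y → F q y)
           (complete : ∀ {q y} → F q y →
                       ∃[ b ] ((F (c b) y × q ≼ c b) ⊎ ∃[ a ] ∃[ t ] (q ≡ c b ++ a ∷ t)))
           (connected : ∀ q → EdgeConnected (λ a y → F (q ∷ʳ a) y)) where

    -- In the second alternative of `complete` a codeword is a proper prefix of `q ∷ʳ a`, hence a
    -- prefix of `q` and a proper prefix of `c b`, against prefix-freeness.
    completeLetter : ∀ q {a y b x s} → c b ≡ q ++ x ∷ s → F (q ∷ʳ a) y →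
                     ∃[ b ] (G above (q ∷ʳ a)) b y
    completeLetter q {a} {b = b} {x} {s} cb≡ Fqa with complete Fqa
    ... | b′ , inj₁ e              = b′ , e
    ... | b′ , inj₂ (a′ , t , qa≡) with cons≡snoc a′ t
    ...   | t′ , z , at≡ with ∷ʳ-injectiveˡ q (c b′ ++ t′)
                            (trans qa≡ (trans (cong (c b′ ++_) at≡) (sym (++-assoc (c b′) t′ [ z ]))))
    ...     | refl with prefixFree {b′} {b} (trans cb≡ (++-assoc (c b′) t′ (x ∷ s)))
    ...       | refl = contradiction (cong length cb≡) (λ eq → <-irrefl eq
                         (≤-<-trans (length-++-≤ˡ (c b)) (nonempty⇒shorter (c b ++ t′) λ ())))

    -- The induction is that of `forest-above`. A path in the graph of next letters after `q` is
    -- lifted link by link: both ends of a link through `x` are completed to codewords above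
    -- `q ∷ʳ x`, where the induction hypothesis applies.
    connected-above : ∀ k q → M ≤ k + length q → ∀ {b y b′ y′} →
                      (G above q) b y → (G above q) b′ y′ → Star (Link G) y y′
    connected-above k q M≤ {b} {b′ = b′} (e , [] , cb≡) (e′ , s′ , cb′≡)
      with prefixFree {b} {b′} (trans cb′≡ (cong (_++ s′) (sym (trans cb≡ (++-identityʳ q)))))
    ... | refl = (b , e , e′) ◅ ε
    connected-above k q M≤ {b} {b′ = b′} (e , s@(_ ∷ _) , cb≡) (e′ , [] , cb′≡)
      with prefixFree {b′} {b} (trans cb≡ (cong (_++ s) (sym (trans cb′≡ (++-identityʳ q)))))
    ... | refl = (b , e , e′) ◅ ε
    connected-above zero q M≤ (e , _ ∷ _ , cb≡) (e′ , _ ∷ _ , cb′≡) =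
      contradiction M≤ (short q cb≡)
    connected-above (suc k) q M≤ (e , a ∷ t , cb≡) (e′ , a′ ∷ t′ , cb′≡) =
      kleisliStar id lift (connected q (first cb≡ e) (first cb′≡ e′))
      where
      first : ∀ {b y a t} → c b ≡ q ++ a ∷ t → G b y → F (q ∷ʳ a) y
      first {b} {y} {a} eq e =
        prefixClosed (q ∷ʳ a) (subst (λ z → F z y) (proj₂ (∷ʳ-≼ {q} eq)) e)
      lift : ∀ {y z} → Link (λ a y → F (q ∷ʳ a) y) y z → Star (Link G) y z
      lift (x , Fy , Fz) =
        let _ , ey = completeLetter q cb≡ Fy
            _ , ez = completeLetter q cb≡ Fz
        in connected-above k (q ∷ʳ x) (suc-shift q x M≤) ey ez

    refine-EdgeConnected : EdgeConnected G
    refine-EdgeConnected e e′ = connected-above M [] (m≤m+n M 0) (e , _ , refl) (e′ , _ , refl)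

-- Extension graphs

module _ {V : Set} where

  NonBacktracking : List V → Set
  NonBacktracking (u ∷ vs@(v ∷ w ∷ _)) = u ≢ w × NonBacktracking vs
  NonBacktracking _                    = ⊤

  tail-NonBacktracking : ∀ u vs → NonBacktracking (u ∷ vs) → NonBacktracking vs
  tail-NonBacktracking u []          _       = tt
  tail-NonBacktracking u (v ∷ [])    _       = tt
  tail-NonBacktracking u (v ∷ w ∷ r) (_ , n) = n

  unique-before : ∀ {x : V} vs {ws} → Unique (vs ++ x ∷ ws) → Unique (x ∷ vs)
  unique-before []       _        = [] ∷ []
  unique-before (v ∷ vs) (v∉ ∷ u) with unique-before vs u | All.++⁻ vs v∉
  ... | x∉ ∷ u′ | v∉vs , v≢x ∷ _ = (v≢x ∘ sym ∷ x∉) ∷ v∉vs ∷ u′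

  unique-rotate : ∀ {x : V} {vs} → Unique (x ∷ vs) → Unique (vs ∷ʳ x)
  unique-rotate (x∉ ∷ u) = AllPairs.++⁺ u ([] ∷ []) (All.map (λ x≢ → (x≢ ∘ sym) ∷ []) x∉)

  module _ {R : V → V → Set} where

    linked-upto : ∀ {x : V} vs {ws} → Linked R (vs ++ x ∷ ws) → Linked R (vs ∷ʳ x)
    linked-upto []           _       = [-]
    linked-upto (v ∷ [])     (r ∷ _) = r ∷ [-]
    linked-upto (v ∷ w ∷ vs) (r ∷ l) = r ∷ linked-upto (w ∷ vs) l

    linked-snoc : ∀ {x y : V} vs → Linked R (vs ∷ʳ x) → R x y → Linked R (vs ∷ʳ x ∷ʳ y)
    linked-snoc []           _       r  = r ∷ [-]
    linked-snoc (v ∷ [])     (r ∷ _) r′ = r ∷ r′ ∷ [-]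
    linked-snoc (v ∷ w ∷ vs) (r ∷ l) r′ = r ∷ linked-snoc (w ∷ vs) l r′

  module _ (G : Graph V) where
    open Graph G

    rotate-IsCycle : ∀ {x v vs} → IsCycle G x (v ∷ vs) → IsCycle G v (vs ∷ʳ x)
    rotate-IsCycle {x} {v} {vs} (2≤ , u , r ∷ l) =
      subst (2 ≤_) (sym (trans (length-++ vs) (+-comm _ 1))) 2≤ ,
      unique-rotate u , linked-snoc (v ∷ vs) l r

    -- If `x` recurs, the walk up to its first return has distinct vertices by induction. A return
    -- after one step is a loop, after two steps a backtracking, and later a cycle.
    nonBacktracking⇒unique : Acyclic G → (∀ {x} → ¬ Adjacent x x) →
      ∀ vs → Linked Adjacent vs → NonBacktracking vs → Unique vs
    nonBacktracking⇒unique acyclic irrefl []       _ _ = []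
    nonBacktracking⇒unique acyclic irrefl (x ∷ vs) l n
      with nonBacktracking⇒unique acyclic irrefl vs (Linked.tail l) (tail-NonBacktracking x vs n)
    ... | unique = All.¬Any⇒All¬ vs x∉vs ∷ unique
      where
      x∉vs : ¬ x ∈ˡ vs
      x∉vs x∈vs with ∈-∃++ x∈vs
      ... | []           , ws , refl = irrefl (Linked.head l)
      ... | v ∷ []       , ws , refl = proj₁ n refl
      ... | us@(_ ∷ _ ∷ _) , ws , refl =
        acyclic x us (s≤s (s≤s z≤n) , unique-before us unique , linked-upto (x ∷ us) l)

module _ {A : Set} {S : WordSet A} {w : Word A} where

  private
    Gw = extensionGraph S w

  connected⇒EdgeConnected : (∀ {a b} → E S w a b → R S w b) →
                            Connected Gw → EdgeConnected (E S w)
  connected⇒EdgeConnected right-vertex connected e e′ =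
    links (connected (right-vertex e) (right-vertex e′))
    where
    links : ∀ {b b′} → Star (ExtensionEdge S w) (inj₂ b) (inj₂ b′) → Star (Link (E S w)) b b′
    links ε                                   = ε
    links (right-left e ◅ left-right e′ ◅ s) = (_ , e , e′) ◅ links s

  -- The first two hypotheses say that no vertex is isolated, since `EdgeConnected` does not see
  -- isolated vertices.
  EdgeConnected⇒connected : (∀ {a} → L S w a → ∃[ b ] E S w a b) →
                            (∀ {b} → R S w b → ∃[ a ] E S w a b) →
                            EdgeConnected (E S w) → Connected Gw
  EdgeConnected⇒connected left-edge right-edge connected {x} {y} = path x y
    where
    walk : ∀ {a b a′ b′} → E S w a b → E S w a′ b′ →
           Star (ExtensionEdge S w) (inj₂ b) (inj₂ b′)
    walk e e′ = kleisliStar inj₂ (λ (_ , e , e′) → right-left e ◅ left-right e′ ◅ ε) (connected e e′)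
    path : ∀ x y → Graph.Vertex Gw x → Graph.Vertex Gw y → Star (ExtensionEdge S w) x y
    path (inj₁ _) (inj₁ _) p q = let _ , e = left-edge p ; _ , e′ = left-edge q in
      left-right e ◅ walk e e′ ◅◅ right-left e′ ◅ ε
    path (inj₁ _) (inj₂ _) p q = let _ , e = left-edge p ; _ , e′ = right-edge q in
      left-right e ◅ walk e e′
    path (inj₂ _) (inj₁ _) p q = let _ , e = right-edge p ; _ , e′ = left-edge q in
      walk e e′ ◅◅ right-left e′ ◅ ε
    path (inj₂ _) (inj₂ _) p q = let _ , e = right-edge p ; _ , e′ = right-edge q in
      walk e e′

  -- A closed trail is a nonbacktracking walk that repeats its first vertex.
  acyclic⇒Forest : Acyclic Gw → Forest (E S w)
  acyclic⇒Forest acyclic t =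
    All.lookup (AllPairs.head (nonBacktracking⇒unique Gw acyclic (λ ()) _ (linked t) (nonBacktracking t)))
      (end t) refl
    where
    rest : ∀ {b a b′} → Trail (E S w) b a b′ → List (A ⊎ A)
    rest {a = a} (edges {y′ = b′} _ _ _)    = inj₁ a ∷ inj₂ b′ ∷ []
    rest {a = a} (cons {y′ = b′} _ _ _ _ t) = inj₁ a ∷ inj₂ b′ ∷ rest t
    linked : ∀ {b a b′} (t : Trail (E S w) b a b′) → Linked (ExtensionEdge S w) (inj₂ b ∷ rest t)
    linked (edges e e′ _)    = right-left e ∷ left-right e′ ∷ [-]
    linked (cons e e′ _ _ t) = right-left e ∷ left-right e′ ∷ linked t
    nonBacktracking : ∀ {b a b′} (t : Trail (E S w) b a b′) → NonBacktracking (inj₂ b ∷ rest t)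
    nonBacktracking (edges _ _ b≢)                    = (λ { refl → b≢ refl }) , tt
    nonBacktracking (cons _ _ b≢ a≢ t@(edges _ _ _))  =
      (λ { refl → b≢ refl }) , (λ { refl → a≢ refl }) , nonBacktracking t
    nonBacktracking (cons _ _ b≢ a≢ t@(cons _ _ _ _ _)) =
      (λ { refl → b≢ refl }) , (λ { refl → a≢ refl }) , nonBacktracking t
    end : ∀ {b a b′} (t : Trail (E S w) b a b′) → inj₂ b′ ∈ˡ rest t
    end (edges _ _ _)    = there (here refl)
    end (cons _ _ _ _ t) = there (there (end t))

  -- The ends may coincide, so that a cycle becomes a closed trail; the last hypothesis rules out
  -- the walk from `b` to a neighbour and straight back.
  linked⇒Trail : ∀ {b b′} vs → Linked (ExtensionEdge S w) (inj₂ b ∷ vs ∷ʳ inj₂ b′) → Unique vs →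
                 All (inj₂ b ≢_) vs → All (inj₂ b′ ≢_) vs → b ≢ b′ ⊎ 2 ≤ length vs →
                 ∃[ a ] ∃[ us ] (vs ≡ inj₁ a ∷ us × Trail (E S w) b a b′)
  linked⇒Trail [] (() ∷ _)
  linked⇒Trail (inj₂ _ ∷ _) (() ∷ _)
  linked⇒Trail (inj₁ _ ∷ inj₁ _ ∷ _) (_ ∷ () ∷ _)
  linked⇒Trail (inj₁ a ∷ []) (right-left e ∷ left-right e′ ∷ _) _ _ _ (inj₁ b≢) =
    a , [] , refl , edges e e′ b≢
  linked⇒Trail (inj₁ a ∷ []) _ _ _ _ (inj₂ (s≤s ()))
  linked⇒Trail (inj₁ a ∷ inj₂ c ∷ vs) (right-left e ∷ left-right e′ ∷ l)
    ((_ ∷ a∉) ∷ c∉ ∷ u) (_ ∷ b≢c ∷ _) (_ ∷ b′≢c ∷ b′∉) _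
    with linked⇒Trail vs l u c∉ b′∉ (inj₁ λ { refl → b′≢c refl })
  ... | a′ , us , refl , t with a∉
  ...   | a≢a′ ∷ _ = a , _ , refl ,
    cons e e′ (λ { refl → b≢c refl }) (λ { refl → a≢a′ refl }) t

  Forest⇒acyclic : Forest (E S w) → Acyclic Gw
  Forest⇒acyclic forest = acyclic
    where
    acyclicʳ : ∀ b vs → ¬ IsCycle Gw (inj₂ b) vs
    acyclicʳ b vs (2≤ , b∉ ∷ u , l) =
      let _ , _ , _ , t = linked⇒Trail vs l u b∉ b∉ (inj₂ 2≤) in forest t
    acyclic : Acyclic Gw
    acyclic (inj₂ b) vs cycle = acyclicʳ b vs cycle
    acyclic (inj₁ a) (inj₁ _ ∷ _) (_ , _ , () ∷ _)
    -- Trails start on the right, so a cycle based on the left is rotated by one vertex.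
    acyclic (inj₁ a) (inj₂ b ∷ vs) cycle = acyclicʳ b (vs ∷ʳ inj₁ a) (rotate-IsCycle Gw cycle)

-- Codes

-- The facts about `S` and the code apart from the tree property, in a form stable under reversal,
-- so that one-sided results can be mirrored. The field `maximal` holds because a word longer than
-- all codewords, with none of them at either end, could be added to the code.
record Decoding {A B : Set} (S : Word A → Set) (f : Word B → Word A) (M : ℕ) : Set where
  field
    empty         : S []
    factor        : ∀ {u w} → S w → u ⊑ w → S u
    extendˡ       : ∀ {w} → S w → ∃[ a ] S (a ∷ w)
    extendʳ       : ∀ {w} → S w → ∃[ a ] S (w ∷ʳ a)
    recurs        : ∀ {u} → S u → ∃[ n ] (∀ {w} → S w → n ≤ length w → u ⊑ w)
    f-[]          : f [] ≡ []
    f-++          : ∀ u v → f (u ++ v) ≡ f u ++ f v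
    code-nonempty : ∀ b → f [ b ] ≢ []
    code-bounded  : ∀ b → length (f [ b ]) ≤ M
    prefixFree    : ∀ {b b′ t t′} → f [ b ] ++ t ≡ f [ b′ ] ++ t′ → b ≡ b′
    suffixFree    : ∀ {b b′ t t′} → t ++ f [ b ] ≡ t′ ++ f [ b′ ] → b ≡ b′
    starts?       : ∀ w → Dec (∃[ b ] f [ b ] ≼ w)
    ends?         : ∀ w → Dec (∃[ b ] f [ b ] ≽ w)
    maximal       : ∀ {w} → S w → M < length w → (∃[ b ] f [ b ] ≼ w) ⊎ (∃[ b ] f [ b ] ≽ w)

mirrorWords : {A : Set} → (Word A → Set) → Word A → Set
mirrorWords S w = S (reverse w)

mirrorMap : {A B : Set} → (Word B → Word A) → Word B → Word A
mirrorMap f w = reverse (f (reverse w))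

mirror : {A B : Set} {S : Word A → Set} {f : Word B → Word A} {M : ℕ} →
         Decoding S f M → Decoding (mirrorWords S) (mirrorMap f) M
mirror {S = S} {f} {M} D = record
  { empty         = empty
  ; factor        = λ Sw u⊑w → factor Sw (reverse-⊑ u⊑w)
  ; extendˡ       = λ {w} Sw → let a , Sw∷ʳa = extendʳ Sw in
                    a , subst S (sym (unfold-reverse a w)) Sw∷ʳa
  ; extendʳ       = λ {w} Sw → let a , Sa∷w = extendˡ Sw in
                    a , subst S (sym (reverse-++ w [ a ])) Sa∷w
  ; recurs        = λ {u} Su → let n , occurs = recurs Su in
                    n , λ {w} Sw n≤ → subst₂ _⊑_ (reverse-involutive u) (reverse-involutive w)
                          (reverse-⊑ (occurs Sw (subst (n ≤_) (sym (length-reverse w)) n≤)))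
  ; f-[]          = cong reverse f-[]
  ; f-++          = λ u v → trans (cong (reverse ∘ f) (reverse-++ u v))
                      (trans (cong reverse (f-++ (reverse v) (reverse u)))
                        (reverse-++ (f (reverse v)) (f (reverse u))))
  ; code-nonempty = λ b eq → code-nonempty b (reverse-injective eq)
  ; code-bounded  = λ b → subst (_≤ M) (sym (length-reverse (f [ b ]))) (code-bounded b)
  ; prefixFree    = λ {b} {b′} {t} {t′} eq → suffixFree {b} {b′} {reverse t} {reverse t′}
                      (trans (unflipˡ (f [ b ]) t)
                        (trans (cong reverse eq) (sym (unflipˡ (f [ b′ ]) t′))))
  ; suffixFree    = λ {b} {b′} {t} {t′} eq → prefixFree {b} {b′} {reverse t} {reverse t′}
                      (trans (unflipʳ t (f [ b ]))
                        (trans (cong reverse eq) (sym (unflipʳ t′ (f [ b′ ])))))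
  ; starts?       = λ w → map′ (λ (b , p) → b , toStart p) (λ (b , p) → b , fromStart p)
                            (ends? (reverse w))
  ; ends?         = λ w → map′ (λ (b , p) → b , toEnd p) (λ (b , p) → b , fromEnd p)
                            (starts? (reverse w))
  ; maximal       = λ {w} Sw M< →
      [ (λ (b , p) → inj₂ (b , toEnd p)) , (λ (b , p) → inj₁ (b , toStart p)) ]′
        (maximal Sw (subst (M <_) (sym (length-reverse w)) M<))
  }
  where
  open Decoding D
  unflipˡ : ∀ u t → reverse t ++ u ≡ reverse (reverse u ++ t)
  unflipˡ u t = trans (cong (reverse t ++_) (sym (reverse-involutive u)))
                      (sym (reverse-++ (reverse u) t))
  unflipʳ : ∀ t u → u ++ reverse t ≡ reverse (t ++ reverse u)
  unflipʳ t u = trans (cong (_++ reverse t) (sym (reverse-involutive u)))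
                      (sym (reverse-++ t (reverse u)))
  toStart : ∀ {u w} → u ≽ reverse w → reverse u ≼ w
  toStart {u} {w} p = subst (reverse u ≼_) (reverse-involutive w) (reverse-≽ p)
  fromStart : ∀ {u w} → reverse u ≼ w → u ≽ reverse w
  fromStart {u} {w} p = subst (_≽ reverse w) (reverse-involutive u) (reverse-≼ p)
  toEnd : ∀ {u w} → u ≼ reverse w → reverse u ≽ w
  toEnd {u} {w} p = subst (reverse u ≽_) (reverse-involutive w) (reverse-≼ p)
  fromEnd : ∀ {u w} → reverse u ≽ w → u ≼ reverse w
  fromEnd {u} {w} p = subst (_≼ reverse w) (reverse-involutive u) (reverse-≽ p)

-- Long words start with a codeword

module OneSided {A B : Set} {S : Word A → Set} {f : Word B → Word A} {M : ℕ}
                (D : Decoding S f M) where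
  open Decoding D

  f-∷ : ∀ b w → f (b ∷ w) ≡ f [ b ] ++ f w
  f-∷ b w = f-++ [ b ] w

  f-length : ∀ w → length w ≤ length (f w)
  f-length []      = z≤n
  f-length (b ∷ w) = ≤-trans (s≤s (f-length w))
    (subst (length (f w) <_) (cong length (sym (f-∷ b w)))
      (nonempty⇒shorterʳ (f [ b ]) (code-nonempty b)))

  abstract

    f-prefix-cancel : ∀ y y′ {t} → f y ++ t ≡ f y′ → ∃[ y″ ] (y′ ≡ y ++ y″ × t ≡ f y″)
    f-prefix-cancel []      y′        eq = y′ , refl , trans (cong (_++ _) (sym f-[])) eq
    f-prefix-cancel (b ∷ y) []        {t} eq =
      contradiction (trans (sym (++-assoc (f [ b ]) (f y) t))
                      (trans (cong (_++ t) (sym (f-∷ b y))) (trans eq f-[])))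
                    λ eq′ → nonempty-++ (code-nonempty b) eq′
      where
      nonempty-++ : ∀ {u v : Word A} → u ≢ [] → u ++ v ≢ []
      nonempty-++ {[]} ne _ = ne refl
    f-prefix-cancel (b ∷ y) (b′ ∷ y′) {t} eq with
      trans (sym (++-assoc (f [ b ]) (f y) t))
        (trans (cong (_++ t) (sym (f-∷ b y))) (trans eq (f-∷ b′ y′)))
    ... | eq′ with prefixFree eq′
    ...   | refl with f-prefix-cancel y y′ (++-cancelˡ (f [ b ]) _ _ eq′)
    ...     | y″ , refl , t≡ = y″ , refl , t≡

  extendʳ-by : ∀ n {w} → S w → ∃[ e ] (length e ≡ n × S (w ++ e))
  extendʳ-by zero    {w} Sw = [] , refl , subst S (sym (++-identityʳ w)) Sw
  extendʳ-by (suc n) {w} Sw =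
    let a , Swa      = extendʳ Sw
        e , len , Se = extendʳ-by n Swa
    in a ∷ e , cong suc len , subst S (++-assoc w [ a ] e) Se

  starts-prefix : ∀ {b} {w v : Word A} → M ≤ length w → f [ b ] ≼ w ++ v → f [ b ] ≼ w
  starts-prefix {b} {w} M≤ (t , eq) =
    let s , w≡ , _ = levi (f [ b ]) w (sym eq) (≤-trans (code-bounded b) M≤) in s , w≡

  module _ (suffixCover : ∀ {v} → S v → M ≤ length v → ∃[ b ] f [ b ] ≽ v) where

    -- Codewords are removed from the end until fewer than `M` letters remain; `n` only bounds the
    -- recursion.
    decodeBackward : ∀ n p → length p ≤ n → S p → ∃[ r ] ∃[ y ] (p ≡ r ++ f y × length r < M)
    decodeBackward n p p≤n Sp with length p <? M
    ... | yes p<M = p , [] , trans (sym (++-identityʳ p)) (cong (p ++_) (sym f-[])) , p<M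
    decodeBackward n p p≤n Sp | no p≮M with suffixCover Sp (≮⇒≥ p≮M)
    ... | b , t , refl with ≤-trans (nonempty⇒shorter t (code-nonempty b)) p≤n
    ... | s≤s t≤n with decodeBackward _ t t≤n (factor Sp (++ˡ⊑ t _))
    ... | r , y , refl , r<M = r , y ++ [ b ] ,
      trans (++-assoc r (f y) (f [ b ])) (cong (r ++_) (sym (f-++ y [ b ]))) , r<M

    -- The i-th occurrence starts after P i; the occurrences are numbered from right to left.
    record Occurrences (w : Word A) (k : ℕ) : Set where
      field
        word         : Word A
        member       : S word
        P Q          : Fin k → Word A
        occurs       : ∀ i → word ≡ P i ++ w ++ Q i
        decreasing   : ∀ {i j} → i Fin.< j → ∃[ x ] (x ≢ [] × P i ≡ P j ++ x)

    occurrences : ∀ {w} → S w → ∀ k → Occurrences w k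
    occurrences {w} Sw zero = record
      { word = w ; member = Sw ; P = λ () ; Q = λ () ; occurs = λ () ; decreasing = λ {} }
    occurrences {w} Sw (suc k) with occurrences Sw k | recurs Sw
    -- The letter `a` keeps the starting positions distinct even when `w` is empty.
    ... | O | n , w-occurs with extendʳ (Occurrences.member O)
    ...   | a , Ssa with extendʳ-by n Ssa
    ...     | e , len , Se
      with w-occurs (factor Se (++ʳ⊑ (Occurrences.word O ∷ʳ a) e)) (≤-reflexive (sym len))
    ...       | l , r , refl = record
      { word       = (s ∷ʳ a) ++ l ++ w ++ r
      ; member     = Se
      ; P          = λ { zero → (s ∷ʳ a) ++ l ; (suc i) → P i }
      ; Q          = λ { zero → r ; (suc i) → Q i ++ a ∷ l ++ w ++ r }
      ; occurs     = λ { zero → sym (++-assoc (s ∷ʳ a) l (w ++ r))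
                       ; (suc i) → occurs′ i (l ++ w ++ r) }
      ; decreasing = λ { {zero} {suc j} _ → w ++ Q j ++ a ∷ l , nonempty w (Q j) , occurs′ j l
                       ; {suc i} {suc j} (s<s i<j) → decreasing i<j }
      }
      where
      open Occurrences O renaming (word to s)
      open ≡-Reasoning
      occurs′ : ∀ i z → (s ∷ʳ a) ++ z ≡ P i ++ w ++ Q i ++ a ∷ z
      occurs′ i z = begin
        (s ∷ʳ a) ++ z                  ≡⟨ ++-assoc s [ a ] z ⟩
        s ++ a ∷ z                     ≡⟨ cong (_++ a ∷ z) (occurs i) ⟩
        (P i ++ w ++ Q i) ++ a ∷ z     ≡⟨ ++-assoc (P i) (w ++ Q i) (a ∷ z) ⟩
        P i ++ (w ++ Q i) ++ a ∷ z     ≡⟨ cong (P i ++_) (++-assoc w (Q i) (a ∷ z)) ⟩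
        P i ++ w ++ Q i ++ a ∷ z       ∎
      nonempty : ∀ u v {z} → u ++ v ++ a ∷ z ≢ []
      nonempty []      []      ()
      nonempty []      (_ ∷ _) ()
      nonempty (_ ∷ _) _       ()

    -- Decode backward from M + 1 occurrences of w.  Two of the undecoded
    -- remainders coincide, so the codewords between these two occurrences
    -- start where the left one does.
    suffixCover⇒starts : ∀ {w} → S w → M ≤ length w → ∃[ b ] f [ b ] ≼ w
    suffixCover⇒starts {w} Sw M≤w = starts (proj₁ (proj₂ cancelled)) (proj₂ (proj₂ cancelled))
      where
      open Occurrences (occurrences Sw (suc M))
      decoded : ∀ i → ∃[ r ] ∃[ y ] (P i ≡ r ++ f y × length r < M)
      decoded i = decodeBackward _ (P i) ≤-refl (factor member (≼⇒⊑ (w ++ Q i , occurs i)))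
      -- Comparing lengths is enough: `P j` is a prefix of `P i`, so remainders of equal length at
      -- their beginnings are equal.
      collision = pigeonhole (n<1+n M) (λ i → fromℕ< (proj₂ (proj₂ (proj₂ (decoded i)))))
      i = proj₁ collision
      j = proj₁ (proj₂ collision)
      i<j = proj₁ (proj₂ (proj₂ collision))
      same = proj₂ (proj₂ (proj₂ collision))
      r = λ i → proj₁ (decoded i)
      y = λ i → proj₁ (proj₂ (decoded i))
      P≡ = λ i → proj₁ (proj₂ (proj₂ (decoded i)))
      x = proj₁ (decreasing i<j)
      open ≡-Reasoning
      same-length : length (r j) ≡ length (r i)
      same-length = trans (sym (toℕ-fromℕ< _)) (trans (cong toℕ (sym same)) (toℕ-fromℕ< _))
      two-decodings : r j ++ f (y j) ++ x ≡ r i ++ f (y i)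
      two-decodings = begin
        r j ++ f (y j) ++ x     ≡⟨ ++-assoc (r j) (f (y j)) x ⟨
        (r j ++ f (y j)) ++ x   ≡⟨ cong (_++ x) (P≡ j) ⟨
        P j ++ x                ≡⟨ proj₂ (proj₂ (decreasing i<j)) ⟨
        P i                     ≡⟨ P≡ i ⟩
        r i ++ f (y i)          ∎
      cancelled : ∃[ y″ ] (y i ≡ y j ++ y″ × x ≡ f y″)
      cancelled = f-prefix-cancel (y j) (y i)
        (proj₂ (++-injective (r j) (r i) two-decodings same-length))
      after : w ++ Q j ≡ x ++ w ++ Q i
      after = ++-cancelˡ (P j) _ _ (begin
        P j ++ w ++ Q j         ≡⟨ occurs j ⟨
        word                    ≡⟨ occurs i ⟩
        P i ++ w ++ Q i         ≡⟨ cong (_++ w ++ Q i) (proj₂ (proj₂ (decreasing i<j))) ⟩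
        (P j ++ x) ++ w ++ Q i  ≡⟨ ++-assoc (P j) x (w ++ Q i) ⟩
        P j ++ x ++ w ++ Q i    ∎)
      starts : ∀ {y″} → y i ≡ y j ++ y″ → x ≡ f y″ → ∃[ b ] f [ b ] ≼ w
      starts {[]}     _ x≡ = contradiction (trans x≡ f-[]) (proj₁ (proj₂ (decreasing i<j)))
      starts {b ∷ y″} _ x≡ = b , starts-prefix M≤w (f y″ ++ w ++ Q i , (begin
        w ++ Q j                            ≡⟨ after ⟩
        x ++ w ++ Q i                       ≡⟨ cong (_++ w ++ Q i) (trans x≡ (f-∷ b y″)) ⟩
        (f [ b ] ++ f y″) ++ w ++ Q i       ≡⟨ ++-assoc (f [ b ]) (f y″) (w ++ Q i) ⟩
        f [ b ] ++ f y″ ++ w ++ Q i         ∎))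

  ends-suffix : ∀ {b} {w v : Word A} → M ≤ length v → f [ b ] ≽ w ++ v → f [ b ] ≽ v
  ends-suffix {b} {w} {v} M≤ (t , eq) with ≤-total (length w) (length t)
  ... | inj₁ w≤t = let s , _ , v≡ = levi w t eq w≤t in s , v≡
  ... | inj₂ t≤w with levi t w (sym eq) t≤w
  ...   | [] , _ , eq′ = [] , sym eq′
  ...   | x ∷ s , _ , eq′ = contradiction (code-bounded b)
    (<⇒≱ (≤-<-trans M≤ (subst (length v <_) (cong length (sym eq′)) (s≤s (length-++-≤ʳ v {s})))))

  -- If w had no codeword as a prefix then, by maximality applied to the words
  -- w … v of S, every long v would have one as a suffix.
  prefixCover : ∀ {w} → S w → M ≤ length w → ∃[ b ] f [ b ] ≼ w
  prefixCover {w} Sw M≤w with starts? w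
  ... | yes s  = s
  ... | no ¬s = contradiction (suffixCover⇒starts suffixCover Sw M≤w) ¬s
    where
    suffixCover : ∀ {v} → S v → M ≤ length v → ∃[ b ] f [ b ] ≽ v
    suffixCover {v} Sv M≤v =
      let n , v-occurs  = recurs Sv
          -- The letter `a` makes `w ++ a ∷ l ++ v` strictly longer than `M`, as `maximal` requires.
          a , Swa       = extendʳ Sw
          e , len , Se  = extendʳ-by n Swa
          l , r , e≡    = v-occurs (factor Se (++ʳ⊑ (w ∷ʳ a) e)) (≤-reflexive (sym len))
          eq : (w ∷ʳ a) ++ e ≡ (w ++ a ∷ l ++ v) ++ r
          eq = trans (++-assoc w [ a ] e) (trans (cong (λ z → w ++ a ∷ z)
                 (trans e≡ (sym (++-assoc l v r)))) (sym (++-assoc w (a ∷ l ++ v) r)))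
      in [ (λ (b , p) → contradiction (b , starts-prefix M≤w p) ¬s)
         , (λ (b , p) → b , ends-suffix {w = w ++ a ∷ l} M≤v
                             (subst (f [ b ] ≽_) (sym (++-assoc w (a ∷ l) v)) p)) ]′
         (maximal (factor Se (r-prefix eq))
           (≤-<-trans M≤w (subst (length w <_) (sym (length-++ w)) (m<m+1+n (length w)))))
      where
      r-prefix : ∀ {u v r : Word A} → u ≡ v ++ r → v ⊑ u
      r-prefix {r = r} eq = ≼⇒⊑ (r , eq)
      m<m+1+n : ∀ m {n} → m < m + suc n
      m<m+1+n m {n} = subst (m <_) (sym (+-suc m n)) (s≤s (m≤m+n m n))

  appendCodeword : ∀ {w} → S w → ∃[ b ] S (w ++ f [ b ])
  appendCodeword {w} Sw =
    let e , len , Se = extendʳ-by M Sw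
        b , t , e≡   = prefixCover (factor Se (++ʳ⊑ w e)) (≤-reflexive (sym len))
    in b , factor Se (subst (w ++ f [ b ] ⊑_) (cong (w ++_) (sym e≡))
             (≼⇒⊑ (t , sym (++-assoc w (f [ b ]) t))))

  -- This is the hypothesis `complete` of the refinement. With `M` more letters the word after `x`
  -- is long enough to start with a codeword, which is then comparable with `q`.
  nextCodeword : ∀ x q → S (x ++ q) →
    ∃[ b ] ((S (x ++ f [ b ]) × q ≼ f [ b ]) ⊎ ∃[ a ] ∃[ t ] (q ≡ f [ b ] ++ a ∷ t))
  nextCodeword x q Sxq with extendʳ-by M Sxq
  ... | e , len , Se
    with prefixCover (factor Se (subst (q ++ e ⊑_) (sym (++-assoc x q e)) (++ʳ⊑ x (q ++ e))))
           (≤-trans (≤-reflexive (sym len)) (length-++-≤ʳ e {q}))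
  ...   | b , t , eq with ≤-total (length q) (length (f [ b ]))
  ...     | inj₁ q≤ with levi q (f [ b ]) eq q≤
  ...       | s , fb≡ , _ = b , inj₁ (factor Se (≼⇒⊑ (t , xqe≡)) , s , fb≡)
    where
    open ≡-Reasoning
    xqe≡ : (x ++ q) ++ e ≡ (x ++ f [ b ]) ++ t
    xqe≡ = begin
      (x ++ q) ++ e        ≡⟨ ++-assoc x q e ⟩
      x ++ q ++ e          ≡⟨ cong (x ++_) eq ⟩
      x ++ f [ b ] ++ t    ≡⟨ ++-assoc x (f [ b ]) t ⟨
      (x ++ f [ b ]) ++ t  ∎
  nextCodeword x q Sxq | e , len , Se | b , t , eq | inj₂ ≤q with levi (f [ b ]) q (sym eq) ≤q
  ... | a ∷ s , q≡ , _ = b , inj₂ (a , s , q≡)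
  ... | [] , q≡ , _ = b , inj₁ (subst (λ z → S (x ++ z)) q≡′ Sxq , [] , trans (sym q≡′) (sym (++-identityʳ q)))
    where
    q≡′ : q ≡ f [ b ]
    q≡′ = trans q≡ (++-identityʳ (f [ b ]))

  coverBy : ∀ n x y → length y ≤ n → S (x ++ y) → ∃[ c ] (S (x ++ f c) × y ≼ f c)
  coverBy n x y y≤n Sxy with nextCodeword x y Sxy
  ... | b , inj₁ (Sxb , y≼) = [ b ] , Sxb , y≼
  ... | b , inj₂ (a , t , refl) with ≤-trans (nonempty⇒shorterʳ (f [ b ]) (code-nonempty b)) y≤n
  ...   | s≤s t≤ with coverBy _ (x ++ f [ b ]) (a ∷ t) t≤ (subst S (sym (++-assoc x (f [ b ]) (a ∷ t))) Sxy)
  ...     | c , Sc , s , fc≡ = b ∷ c ,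
    subst S (trans (++-assoc x (f [ b ]) (f c)) (cong (x ++_) (sym (f-∷ b c)))) Sc ,
    s , trans (f-∷ b c) (trans (cong (f [ b ] ++_) fc≡) (sym (++-assoc (f [ b ]) (a ∷ t) s)))

  cover : ∀ x y → S (x ++ y) → ∃[ c ] (S (x ++ f c) × y ≼ f c)
  cover x y = coverBy (length y) x y ≤-refl

  -- The word `f e₁` ends at the first codeword boundary at or after the end of `X`; the overshoot
  -- `x` lies within one codeword, hence the bound `M`.
  cut : ∀ e X {Y} → f e ≡ X ++ Y →
        ∃[ e₁ ] ∃[ e₂ ] ∃[ x ] (e ≡ e₁ ++ e₂ × f e₁ ≡ X ++ x × Y ≡ x ++ f e₂ × length x ≤ M)
  cut e [] eq = [] , e , [] , refl , f-[] , sym eq , z≤n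
  cut [] (_ ∷ _) eq = contradiction (trans (sym f-[]) eq) λ ()
  cut (b ∷ e) X@(_ ∷ _) {Y} eq with ≤-total (length X) (length (f [ b ]))
  ... | inj₁ X≤ with levi X (f [ b ]) (trans (sym eq) (f-∷ b e)) X≤
  ...   | x , fb≡ , Y≡ = [ b ] , e , x , refl , fb≡ , Y≡ ,
    ≤-trans (length-++-≤ʳ x {X}) (subst (_≤ M) (cong length fb≡) (code-bounded b))
  cut (b ∷ e) X@(_ ∷ _) {Y} eq | inj₂ ≤X with levi (f [ b ]) X (trans (sym (f-∷ b e)) eq) ≤X
  ...   | X′ , X≡ , fe≡ with cut e X′ fe≡
  ...     | e₁ , e₂ , x , refl , fe₁≡ , Y≡ , x≤ = b ∷ e₁ , e₂ , x , refl ,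
    trans (f-∷ b e₁) (trans (cong (f [ b ] ++_) fe₁≡)
      (trans (sym (++-assoc (f [ b ]) X′ x)) (cong (_++ x) (sym X≡)))) , Y≡ , x≤

  module _ {Y : Set} (_≟_ : DecidableEquality A) (x : Y → Word A) where

    private
      -- The vertex `y` stands for the left context `x y`, and `q` is the part of a codeword read
      -- after it.
      open module Ref = Refinement _≟_ (λ b → f [ b ]) M code-bounded
        (λ {b} {b′} eq → prefixFree {b} {b′} (trans (sym eq) (sym (++-identityʳ (f [ b′ ])))))
        (λ q y → S (x y ++ q))

      prefixClosed : ∀ q {t y} → S (x y ++ q ++ t) → S (x y ++ q)
      prefixClosed q {t} {y} Sxqt =
        factor Sxqt (≼⇒⊑ (t , sym (++-assoc (x y) q t)))

    codeword-Forest : (∀ q → Forest (λ a y → S (x y ++ q ∷ʳ a))) →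
                      Forest (λ b y → S (x y ++ f [ b ]))
    codeword-Forest = refine-Forest prefixClosed

    codeword-EdgeConnected : (∀ q → EdgeConnected (λ a y → S (x y ++ q ∷ʳ a))) →
                             EdgeConnected (λ b y → S (x y ++ f [ b ]))
    codeword-EdgeConnected =
      refine-EdgeConnected prefixClosed (λ {q} {y} → nextCodeword (x y) q)

-- Codewords on both sides, and the extension graphs of the decoding

module TwoSided {A B : Set} {S : Word A → Set} {f : Word B → Word A} {M : ℕ}
                (D : Decoding S f M) where
  open Decoding D
  open OneSided D public
  private
    module Mirror = OneSided (mirror D)

  prependCodeword : ∀ {w} → S w → ∃[ b ] S (f [ b ] ++ w)
  prependCodeword {w} Sw =
    let b , Sb = Mirror.appendCodeword {reverse w} (subst S (sym (reverse-involutive w)) Sw)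
    in b , subst S (trans (sym (cong reverse (reverse-++ (f [ b ]) w))) (reverse-involutive _)) Sb

  reverse-reverse-++ : ∀ (x p : Word A) → reverse (reverse x ++ p) ≡ reverse p ++ x
  reverse-reverse-++ x p =
    trans (reverse-++ (reverse x) p) (cong (reverse p ++_) (reverse-involutive x))

  abstract

    coverˡ : ∀ x y → S (x ++ y) → ∃[ c ] (S (f c ++ y) × x ≽ f c)
    coverˡ x y Sxy with Mirror.cover (reverse y) (reverse x)
      (subst S (sym (trans (reverse-reverse-++ y (reverse x))
                           (cong (_++ y) (reverse-involutive x)))) Sxy)
    ... | c , Sc , x≼ = reverse c ,
      subst S (trans (reverse-reverse-++ y _) (cong (_++ y) (reverse-involutive _))) Sc ,
      subst₂ _≽_ (reverse-involutive x) (reverse-involutive _) (reverse-≼ x≼)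

  -- Any position in a word of `S` can be made a codeword boundary: `y` is completed to codewords on
  -- the right, then `x` on the left.
  factorise : ∀ x y → S (x ++ y) →
              ∃[ c₁ ] ∃[ c₂ ] (S (f (c₁ ++ c₂)) × x ≽ f c₁ × y ≼ f c₂)
  factorise x y Sxy with cover x y Sxy
  ... | c₂ , Sc₂ , y≼ with coverˡ x (f c₂) Sc₂
  ...   | c₁ , Sc , x≽ = c₁ , c₂ , subst S (sym (f-++ c₁ c₂)) Sc , x≽ , y≼

  abstract

    f-suffix-cancel : ∀ y y′ {t} → t ++ f y ≡ f y′ → ∃[ y″ ] (y′ ≡ y″ ++ y × t ≡ f y″)
    f-suffix-cancel y y′ {t} eq with Mirror.f-prefix-cancel (reverse y) (reverse y′) {reverse t}
      (trans (cong (λ z → reverse (f z) ++ reverse t) (reverse-involutive y))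
        (trans (sym (reverse-++ t (f y)))
          (trans (cong reverse eq) (cong (reverse ∘ f) (sym (reverse-involutive y′))))))
    ... | y″ , y′≡ , t≡ = reverse y″ ,
      reverse-injective (trans y′≡ (sym (trans (reverse-++ (reverse y″) y)
        (cong (reverse y ++_) (reverse-involutive y″))))) ,
      reverse-injective t≡

  f-bracket : ∀ b w b′ → f (b ∷ w ∷ʳ b′) ≡ f [ b ] ++ f w ++ f [ b′ ]
  f-bracket b w b′ = trans (f-∷ b (w ∷ʳ b′)) (cong (f [ b ] ++_) (f-++ w [ b′ ]))

  module _ (_≟_ : DecidableEquality A) where

    private
      snoc-assoc : ∀ a (v q : Word A) b → a ∷ v ++ q ∷ʳ b ≡ a ∷ (v ++ q) ∷ʳ b
      snoc-assoc a v q b = cong (a ∷_) (sym (++-assoc v q [ b ]))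

      reverse-snoc : ∀ v b p a → reverse (reverse (v ++ f [ b ]) ++ p ∷ʳ a) ≡
                                 a ∷ (reverse p ++ v) ++ f [ b ]
      reverse-snoc v b p a = trans (reverse-reverse-++ (v ++ f [ b ]) (p ∷ʳ a))
        (trans (cong (_++ v ++ f [ b ]) (reverse-++ p [ a ]))
          (cong (a ∷_) (sym (++-assoc (reverse p) v (f [ b ])))))

      reverse-bracket : ∀ w b b′ → reverse (reverse (f w ++ f [ b′ ]) ++ reverse (f [ b ])) ≡
                                   f (b ∷ w ∷ʳ b′)
      reverse-bracket w b b′ = trans (reverse-reverse-++ (f w ++ f [ b′ ]) (reverse (f [ b ])))
        (trans (cong (_++ f w ++ f [ b′ ]) (reverse-involutive (f [ b ]))) (sym (f-bracket b w b′)))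

    -- First the right letters are refined to codewords, for a fixed middle word and single left
    -- letters. The graph is then flipped, and the mirrored refinement treats the left letters. The
    -- parts `q` and `p` of codewords already read join the middle word, so extension graphs of
    -- longer words are needed.
    decoding-Forest : (∀ v → Forest (E S v)) → ∀ w → Forest (E (f ⊢ S) w)
    decoding-Forest forest w =
      map-Forest (λ {b} {b′} → subst S (sym (reverse-bracket w b b′)))
        (Mirror.codeword-Forest _≟_ (λ b → reverse (f w ++ f [ b ])) λ p →
          map-Forest (λ {a} {b} → subst S (reverse-snoc (f w) b p a))
            (flip-Forest (right (reverse p ++ f w))))
      where
      right : ∀ v → Forest (λ b a → S (a ∷ v ++ f [ b ]))
      right v = codeword-Forest _≟_ (_∷ v) λ q →
        map-Forest (λ {b} {a} → subst S (snoc-assoc a v q b)) (flip-Forest (forest (v ++ q)))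

    decoding-EdgeConnected : (∀ v → EdgeConnected (E S v)) → ∀ w → EdgeConnected (E (f ⊢ S) w)
    decoding-EdgeConnected connected w =
      map-EdgeConnected (λ {b} {b′} → subst S (reverse-bracket w b b′))
        (λ {b} {b′} → subst S (sym (reverse-bracket w b b′)))
        (Mirror.codeword-EdgeConnected _≟_ (λ b → reverse (f w ++ f [ b ])) λ p →
          map-EdgeConnected (λ {a} {b} → subst S (sym (reverse-snoc (f w) b p a)))
            (λ {a} {b} → subst S (reverse-snoc (f w) b p a))
            (flip-EdgeConnected (right (reverse p ++ f w))))
      where
      right : ∀ v → EdgeConnected (λ b a → S (a ∷ v ++ f [ b ]))
      right v = codeword-EdgeConnected _≟_ (_∷ v) λ q →
        map-EdgeConnected (λ {b} {a} → subst S (sym (snoc-assoc a v q b)))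
          (λ {b} {a} → subst S (snoc-assoc a v q b)) (flip-EdgeConnected (connected (v ++ q)))

-- Recurrence

module Zigzag {B : Set} (T : WordSet B) (factor : ∀ {u w} → T w → u ⊑ w → T u)
              (extendʳ : ∀ {w} → T w → ∃[ b ] T (w ∷ʳ b))
              (connected : ∀ {w} → T w → Connected (extensionGraph T w)) where

  Long : ℕ → Word B → Set
  Long n w = n ≤ length w × T w

  Step : ℕ → Word B → Word B → Set
  Step n e e′ = Long n e × Long n e′ × (e ⊑ e′ ⊎ e′ ⊑ e)

  module _ (h : Word B) where

    -- A vertex of the extension graph of `h` is read as the one-letter extension of `h` that it
    -- stands for; an edge then becomes two steps through `a ∷ h ∷ʳ b`.
    vertexWord : B ⊎ B → Word B
    vertexWord (inj₁ a) = a ∷ h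
    vertexWord (inj₂ b) = h ∷ʳ b

    vertexWord-length : ∀ v → length (vertexWord v) ≡ suc (length h)
    vertexWord-length (inj₁ a) = refl
    vertexWord-length (inj₂ b) = trans (length-++ h) (+-comm _ 1)

    vertexWord-long : ∀ v → T (vertexWord v) → Long (suc (length h)) (vertexWord v)
    vertexWord-long v Tv = ≤-reflexive (sym (vertexWord-length v)) , Tv

    longerFactor : ∀ {g} → h ⊑ g → suc (length h) ≤ length g → ∃[ v ] (vertexWord v ⊑ g)
    longerFactor (l , b ∷ r , refl) _ =
      inj₂ b , l , r , cong (l ++_) (sym (++-assoc h [ b ] r))
    longerFactor ([] , [] , refl) le =
      contradiction le (<⇒≱ (s≤s (≤-reflexive (cong length (++-identityʳ h)))))
    longerFactor (a ∷ l , [] , refl) _ with cons≡snoc a l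
    ... | l′ , b , eq = inj₁ b , l′ , [] ,
      trans (cong (_++ h ++ []) eq) (++-assoc l′ [ b ] (h ++ []))

    edge-word : ∀ {a b} → E T h a b →
                a ∷ h ⊑ a ∷ h ∷ʳ b × h ∷ʳ b ⊑ a ∷ h ∷ʳ b × Long (suc (length h)) (a ∷ h ∷ʳ b)
    edge-word {a} {b} e = ≼⇒⊑ ([ b ] , refl) , ++ʳ⊑ [ a ] (h ∷ʳ b) , s≤s (length-++-≤ˡ h) , e

    edge-steps : ∀ {v v′} → ExtensionEdge T h v v′ →
                 Star (Step (suc (length h))) (vertexWord v) (vertexWord v′)
    edge-steps (left-right {a} {b} e) =
      let ⊑ˡ , ⊑ʳ , long = edge-word e
      in (vertexWord-long (inj₁ a) (factor e ⊑ˡ) , long , inj₁ ⊑ˡ) ◅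
         (long , vertexWord-long (inj₂ b) (factor e ⊑ʳ) , inj₂ ⊑ʳ) ◅ ε
    edge-steps (right-left {a} {b} e) =
      let ⊑ˡ , ⊑ʳ , long = edge-word e
      in (vertexWord-long (inj₂ b) (factor e ⊑ʳ) , long , inj₁ ⊑ʳ) ◅
         (long , vertexWord-long (inj₁ a) (factor e ⊑ˡ) , inj₂ ⊑ˡ) ◅ ε

    -- Both words are longer than `h`, so each contains a one-letter extension of `h`, and the
    -- extension graph of `h` joins these two vertices.
    common-factor-steps : ∀ {g g′} → h ⊑ g → h ⊑ g′ →
      Long (suc (length h)) g → Long (suc (length h)) g′ → Star (Step (suc (length h))) g g′
    common-factor-steps h⊑g h⊑g′ (le , Tg) (le′ , Tg′)
      with longerFactor h⊑g le | longerFactor h⊑g′ le′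
    ... | v , v⊑g | v′ , v′⊑g′ =
      ((le , Tg) , vertexWord-long v Tv , inj₂ v⊑g) ◅
      (kleisliStar vertexWord edge-steps (connected (factor Tg h⊑g) {v} {v′} (vertex v Tv) (vertex v′ Tv′)) ◅◅
       (vertexWord-long v′ Tv′ , (le′ , Tg′) , inj₁ v′⊑g′) ◅ ε)
      where
      Tv = factor Tg v⊑g
      Tv′ = factor Tg′ v′⊑g′
      vertex : ∀ v → T (vertexWord v) → Graph.Vertex (extensionGraph T h) v
      vertex (inj₁ _) Tv = Tv
      vertex (inj₂ _) Tv = Tv

  shorten : ∀ n (w : Word B) → n ≤ length w → ∃[ h ] (length h ≡ n × h ⊑ w)
  shorten n w n≤ = take n w , trans (length-take n w) (m≤n⇒m⊓n≡m n≤) ,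
    ≼⇒⊑ (drop n w , sym (take++drop≡id n w))

  -- Each word d of the given path is replaced by a longer one d ∷ʳ b; neighbouring
  -- words still share a factor h of length n, and the extension graph of h connects them.
  lift-steps : ∀ {n e e′ g g′} → Star (Step n) e e′ → Long n e → e ⊑ g → e′ ⊑ g′ →
               Long (suc n) g → Long (suc n) g′ → Star (Step (suc n)) g g′
  lift-steps {n} {e} ε (n≤ , _) e⊑g e⊑g′ long-g long-g′ with shorten n e n≤
  ... | h , refl , h⊑e = common-factor-steps h (⊑-trans h⊑e e⊑g) (⊑-trans h⊑e e⊑g′) long-g long-g′
  lift-steps {n} {e} {g = g} (_◅_ {j = d} (_ , long-d@(n≤d , Td) , comparable) s) (n≤e , Te)
             e⊑g e′⊑g′ long-g long-g′
    with extendʳ Td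
  ... | b , Tdb = via comparable ◅◅ lift-steps s long-d (++ˡ⊑ d [ b ]) e′⊑g′ long-db long-g′
    where
    long-db : Long (suc n) (d ∷ʳ b)
    long-db = subst (suc n ≤_) (sym (vertexWord-length d (inj₂ b))) (s≤s n≤d) , Tdb
    via : e ⊑ d ⊎ d ⊑ e → Star (Step (suc n)) g (d ∷ʳ b)
    via (inj₁ e⊑d) with shorten n e n≤e
    ... | h , refl , h⊑e = common-factor-steps h (⊑-trans h⊑e e⊑g)
      (⊑-trans h⊑e (⊑-trans e⊑d (++ˡ⊑ d [ b ]))) long-g long-db
    via (inj₂ d⊑e) with shorten n d n≤d
    ... | h , refl , h⊑d = common-factor-steps h (⊑-trans h⊑d (⊑-trans d⊑e e⊑g))
      (⊑-trans h⊑d (++ˡ⊑ d [ b ])) long-g long-db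

  steps : ∀ n {e e′} → Long n e → Long n e′ → Star (Step n) e e′
  -- Without a length bound the path may pass through the empty word.
  steps zero {e} {e′} long long′ =
    (long , ([]-long , inj₂ ([]⊑ e))) ◅ ([]-long , long′ , inj₁ ([]⊑ e′)) ◅ ε
    where
    []⊑ : ∀ w → [] ⊑ w
    []⊑ w = ++ˡ⊑ [] w
    []-long = z≤n , factor (proj₂ long) ([]⊑ e)
  steps (suc n) (n< , Te) (n<′ , Te′) =
    lift-steps (steps n (<⇒≤ n< , Te) (<⇒≤ n<′ , Te′)) (<⇒≤ n< , Te) ⊑-refl ⊑-refl
      (n< , Te) (n<′ , Te′)

-- Forced readings and uniform recurrence

module Recurrence {A B : Set} {S : Word A → Set} {f : Word B → Word A} {M : ℕ} (D : Decoding S f M)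
  (connected : ∀ {w} → S (f w) → Connected (extensionGraph (f ⊢ S) w)) where
  open Decoding D
  open TwoSided D

  f-⊑ : ∀ {u w} → u ⊑ w → f u ⊑ f w
  f-⊑ {u} (l , r , refl) = f l , f r , trans (f-++ l (u ++ r)) (cong (f l ++_) (f-++ u r))

  decoding-factor : ∀ {u w} → S (f w) → u ⊑ w → S (f u)
  decoding-factor Sfw u⊑w = factor Sfw (f-⊑ u⊑w)

  decoding-extendʳ : ∀ {w} → S (f w) → ∃[ b ] S (f (w ∷ʳ b))
  decoding-extendʳ {w} Sfw =
    let b , Sb = appendCodeword Sfw in b , subst S (sym (f-++ w [ b ])) Sb

  open Zigzag (f ⊢ S) decoding-factor decoding-extendʳ connected

  extendToLong : ∀ n {e} → S (f e) → ∃[ e′ ] (Long n e′ × e ⊑ e′)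
  extendToLong zero    Sfe = _ , (z≤n , Sfe) , ⊑-refl
  extendToLong (suc n) Sfe with extendToLong n Sfe
  ... | e′ , (n≤ , Sfe′) , e⊑e′ with decoding-extendʳ Sfe′
  ...   | b , Sb = e′ ∷ʳ b ,
    (subst (suc n ≤_) (sym (trans (length-++ e′) (+-comm _ 1))) (s≤s n≤) , Sb) ,
    ⊑-trans e⊑e′ (++ˡ⊑ e′ [ b ])

  -- An occurrence of l ++ r in f e such that position i of r is a cut of the
  -- factorisation of f e into codewords.
  record Occurs (e : Word B) (l r : Word A) (i : Fin (suc M)) : Set where
    constructor occ
    field
      {e₁ e₂} : Word B
      {r₀ r₁} : Word A
      e≡      : e ≡ e₁ ++ e₂
      r≡      : r ≡ r₀ ++ r₁
      position : length r₀ ≡ toℕ i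
      left    : l ++ r₀ ≽ f e₁
      right   : r₁ ≼ f e₂

  occurs-⊑ : ∀ {e e′ l r i} → Occurs e l r i → e ⊑ e′ → Occurs e′ l r i
  occurs-⊑ (occ {e₁} {e₂} {r₀} {r₁} refl r≡ pos (s , fe₁≡) (t , fe₂≡)) (p , q , refl) =
    occ {e₁ = p ++ e₁} {e₂ ++ q} (trans (cong (p ++_) (++-assoc e₁ e₂ q)) (sym (++-assoc p e₁ (e₂ ++ q))))
      r≡ pos
      (f p ++ s , trans (f-++ p e₁) (trans (cong (f p ++_) fe₁≡) (sym (++-assoc (f p) s _))))
      (t ++ f q , trans (f-++ e₂ q) (trans (cong (_++ f q) fe₂≡) (++-assoc r₁ t (f q))))

  -- The first boundary at or after the end of `l` overshoots by at most `M` letters and thus falls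
  -- into `r`, so only `M + 1` positions have to be considered.
  locate : ∀ e l r → M ≤ length r → l ++ r ⊑ f e → ∃[ i ] Occurs e l r i
  locate e l r M≤r (g , h , fe≡)
    with cut e (g ++ l) (trans fe≡ (trans (cong (g ++_) (++-assoc l r h)) (sym (++-assoc g l (r ++ h)))))
  ... | e₁ , e₂ , x , e≡ , fe₁≡ , rh≡ , x≤M with levi x r (sym rh≡) (≤-trans x≤M M≤r)
  ...   | t , r≡ , fe₂≡ = fromℕ< (s≤s x≤M) ,
    occ e≡ r≡ (sym (toℕ-fromℕ< (s≤s x≤M))) (g , trans fe₁≡ (++-assoc g l x)) (h , fe₂≡)

  parseThrough : ∀ l r (i : Fin (suc M)) → S (l ++ r) → M ≤ length r →
                 ∃[ e ] (S (f e) × Occurs e l r i)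
  parseThrough l r i Slr M≤r =
    let r₀ = take (toℕ i) r
        r₁ = drop (toℕ i) r
        split = take++drop≡id (toℕ i) r
        c₁ , c₂ , Sc , lr₀≽ , r₁≼ = factorise (l ++ r₀) r₁
          (subst S (sym (trans (++-assoc l r₀ r₁) (cong (l ++_) split))) Slr)
    in c₁ ++ c₂ , Sc ,
       occ refl (sym split)
         (trans (length-take (toℕ i) r) (m≤n⇒m⊓n≡m (≤-trans (toℕ≤pred[n] i) M≤r))) lr₀≽ r₁≼

  module _ {u : Word B} (Sfu : S (f u)) where

    -- Every factorisation into codewords of a word around l ++ r that cuts r
    -- at position i reads u.
    record Visited (l r : Word A) (i : Fin (suc M)) : Set where
      constructor vis
      field
        {y₁ y₂} : Word B
        {r₀ r₁} : Word A
        r≡       : r ≡ r₀ ++ r₁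
        position : length r₀ ≡ toℕ i
        left     : f y₁ ≽ l ++ r₀
        right    : f y₂ ≼ r₁
        reads    : u ⊑ y₁ ++ y₂

    visited-extend : ∀ {l r i} g h → Visited l r i → Visited (g ++ l) (r ++ h) i
    visited-extend {l} g h (vis {y₁} {y₂} {r₀} {r₁} r≡ pos (s , lr₀≡) (t , r₁≡) reads) =
      vis (trans (cong (_++ h) r≡) (++-assoc r₀ r₁ h)) pos
        (g ++ s , trans (++-assoc g l r₀) (trans (cong (g ++_) lr₀≡) (sym (++-assoc g s (f y₁)))))
        (t ++ h , trans (cong (_++ h) r₁≡) (++-assoc (f y₂) t h))
        reads

    -- From a given cut the factorisation is determined in both directions: suffix-freeness makes
    -- `e₁` end with `y₁`, and prefix-freeness makes `e₂` start with `y₂`.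
    visited⇒reads : ∀ {e l r i} → Occurs e l r i → Visited l r i → u ⊑ e
    visited⇒reads {l = l} (occ {e₁} {e₂} {r₀} {r₁} refl r≡ pos (s , fe₁≡) (t , fe₂≡))
                          (vis {y₁} {y₂} {q₀} {q₁} r≡′ pos′ (s′ , lr₀≡) (t′ , r₁≡) reads)
      with ++-injective r₀ q₀ (trans (sym r≡) r≡′) (trans pos (sym pos′))
    ... | refl , refl
      with f-suffix-cancel y₁ e₁ (trans (++-assoc s s′ (f y₁)) (trans (cong (s ++_) (sym lr₀≡)) (sym fe₁≡)))
         | f-prefix-cancel y₂ e₂ (trans (sym (++-assoc (f y₂) t′ t)) (trans (cong (_++ t) (sym r₁≡)) (sym fe₂≡)))
    ...   | z₁ , refl , _ | z₂ , refl , _ = ⊑-trans reads (z₁ , z₂ ,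
      trans (++-assoc z₁ y₁ (y₂ ++ z₂)) (cong (z₁ ++_) (sym (++-assoc y₁ y₂ z₂))))

    -- Once `l ++ r` is enlarged to all of `f e`, the words `e₁` and `e₂` are themselves the forced
    -- reading. The position is counted from the start of `r` and does not move.
    reads⇒visited : ∀ {e l r i} → S (f e) → Occurs e l r i → u ⊑ e →
      ∃[ g ] ∃[ h ] (S ((g ++ l) ++ r ++ h) × Visited (g ++ l) (r ++ h) i)
    reads⇒visited {l = l} Sfe (occ {e₁} {e₂} {r₀} {r₁} refl refl pos (g , fe₁≡) (h , fe₂≡)) u⊑e =
      g , h , subst S fe≡ Sfe ,
      vis (++-assoc r₀ r₁ h) pos ([] , sym fe₁≡′) ([] , trans (sym fe₂≡) (sym (++-identityʳ (f e₂)))) u⊑e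
      where
      open ≡-Reasoning
      fe₁≡′ : f e₁ ≡ (g ++ l) ++ r₀
      fe₁≡′ = trans fe₁≡ (sym (++-assoc g l r₀))
      fe≡ : f (e₁ ++ e₂) ≡ (g ++ l) ++ (r₀ ++ r₁) ++ h
      fe≡ = begin
        f (e₁ ++ e₂)                    ≡⟨ f-++ e₁ e₂ ⟩
        f e₁ ++ f e₂                    ≡⟨ cong₂ _++_ fe₁≡′ fe₂≡ ⟩
        ((g ++ l) ++ r₀) ++ r₁ ++ h     ≡⟨ ++-assoc (g ++ l) r₀ (r₁ ++ h) ⟩
        (g ++ l) ++ r₀ ++ r₁ ++ h       ≡⟨ cong ((g ++ l) ++_) (++-assoc r₀ r₁ h) ⟨
        (g ++ l) ++ (r₀ ++ r₁) ++ h     ∎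

    module _ {l r : Word A} (M≤r : M ≤ length r) (rem : List (Fin (suc M)))
             (invariant : ∀ i → i ∈ˡ rem ⊎ Visited l r i)
             {n : ℕ} (lr-occurs : ∀ {w} → S w → n ≤ length w → l ++ r ⊑ w) where

      -- Along the path from a word with an unvisited occurrence to a word
      -- containing u, some word has both.
      walk : ∀ {e e′ i} → Star (Step n) e e′ → S (f e) → Occurs e l r i → i ∈ˡ rem → u ⊑ e′ →
             ∃[ d ] ∃[ j ] (S (f d) × Occurs d l r j × j ∈ˡ rem × u ⊑ d)
      walk ε Sfe o i∈ u⊑ = _ , _ , Sfe , o , i∈ , u⊑
      walk ((_ , (_ , Sfd) , inj₁ e⊑d) ◅ s) Sfe o i∈ u⊑ = walk s Sfd (occurs-⊑ o e⊑d) i∈ u⊑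
      -- A factor `d` of `e` may lose the occurrence, but `f d` is long enough to contain another
      -- one. If its position is in `rem`, the walk goes on; if it is visited, `d` and hence `e`
      -- contains `u`, while `e` still has its occurrence at a position in `rem`.
      walk {e} (_◅_ {j = d} (_ , (n≤d , Sfd) , inj₂ d⊑e) s) Sfe o i∈ u⊑
        with locate d l r M≤r (lr-occurs Sfd (≤-trans n≤d (f-length d)))
      ... | j , o′ with invariant j
      ...   | inj₁ j∈ = walk s Sfd o′ j∈ u⊑
      ...   | inj₂ v  = e , _ , Sfe , o , i∈ , ⊑-trans (visited⇒reads o′ v) d⊑e

      abstract

        -- The position `j` gained need not be `i`, since the walk may pass to other positions in
        -- `rem`.
        progress : ∀ {i} → i ∈ˡ rem → S (l ++ r) →
          ∃[ g ] ∃[ h ] ∃[ j ] (j ∈ˡ rem × S ((g ++ l) ++ r ++ h) × Visited (g ++ l) (r ++ h) j)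
        progress {i} i∈ Slr =
          let e , Sfe , o                 = parseThrough l r i Slr M≤r
              e′ , long , e⊑e′            = extendToLong n Sfe
              u′ , long′ , u⊑u′           = extendToLong n Sfu
              d , j , Sfd , o′ , j∈ , u⊑d =
                walk (steps n long long′) (proj₂ long) (occurs-⊑ o e⊑e′) i∈ u⊑u′
              g , h , Sglrh , v           = reads⇒visited Sfd o′ u⊑d
          in g , h , j , j∈ , Sglrh , v

    remove : ∀ {j} {rem : List (Fin (suc M))} → j ∈ˡ rem →
             ∃[ rem′ ] (length rem ≡ suc (length rem′) × (∀ {i} → i ∈ˡ rem → i ≡ j ⊎ i ∈ˡ rem′))
    remove {rem = j ∷ rem} (here refl) = rem , refl , λ { (here p) → inj₁ p ; (there i∈) → inj₂ i∈ }
    remove {rem = k ∷ rem} (there j∈) =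
      let rem′ , len , split = remove j∈
      in k ∷ rem′ , cong suc len , λ { (here p) → inj₂ (here p)
                                     ; (there i∈) → [ inj₁ , inj₂ ∘ there ]′ (split i∈) }

    -- rem lists the positions at which l ++ r still has to be extended.
    saturate : ∀ k rem → length rem ≤ k → ∀ l r → S (l ++ r) → M ≤ length r →
               (∀ i → i ∈ˡ rem ⊎ Visited l r i) →
               ∃[ l ] ∃[ r ] (S (l ++ r) × M ≤ length r × (∀ i → Visited l r i))
    saturate k [] _ l r Slr M≤r invariant =
      l , r , Slr , M≤r , λ i → [ (λ ()) , id ]′ (invariant i)
    saturate (suc k) rem@(_ ∷ _) (s≤s rem≤) l r Slr M≤r invariant
      with progress M≤r rem invariant (proj₂ (recurs Slr)) (here refl) Slr
    ... | g , h , j , j∈ , Sglrh , v with remove j∈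
    ...   | rem′ , len , split =
      saturate k rem′ (≤-trans (≤-reflexive (suc-injective (sym len))) rem≤) (g ++ l) (r ++ h) Sglrh
        (≤-trans M≤r (length-++-≤ˡ r)) λ i → [ stays i , inj₂ ∘ visited-extend g h ]′ (invariant i)
      where
      stays : ∀ i → i ∈ˡ rem → i ∈ˡ rem′ ⊎ Visited (g ++ l) (r ++ h) i
      stays i i∈ with split i∈
      ... | inj₁ refl = inj₂ v
      ... | inj₂ i∈′  = inj₁ i∈′

    -- In the saturated word every cut forces `u`. The bound for `l ++ r` in `S` carries over
    -- because `f` does not shorten words.
    decoding-recurs : ∃[ n ] (∀ {w} → S (f w) → n ≤ length w → u ⊑ w)
    decoding-recurs =
      let r , len , Sr               = extendʳ-by M empty
          -- At the start nothing is visited, and an `r` of length `M` has room for all `M + 1`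
          -- positions.
          l , r , Slr , M≤r , visited = saturate _ (allFin (suc M)) ≤-refl [] r Sr
                                         (≤-reflexive (sym len)) (λ i → inj₁ (∈-allFin i))
          n , lr-occurs              = recurs Slr
      in n , λ {w} Sfw n≤w →
        let i , o = locate w l r M≤r (lr-occurs Sfw (≤-trans n≤w (f-length w)))
        in visited⇒reads o (visited i)

-- Translation to the relations of the statement

≼⇒prefix : {A : Set} {u w : Word A} → u ≼ w → u isPrefixOf w
≼⇒prefix {u = u} (t , refl) = Prefix.fromView (≡⇒Pointwise-≡ refl Prefix.++ t)

prefix⇒≼ : {A : Set} {u w : Word A} → u isPrefixOf w → u ≼ w
prefix⇒≼ p with Prefix.toView p
... | eq Prefix.++ t = t , cong (_++ t) (sym (Pointwise-≡⇒≡ eq))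

≽⇒suffix : {A : Set} {u w : Word A} → u ≽ w → u isSuffixOf w
≽⇒suffix (t , refl) = Suffix.fromView (t Suffix.++ ≡⇒Pointwise-≡ refl)

suffix⇒≽ : {A : Set} {u w : Word A} → u isSuffixOf w → u ≽ w
suffix⇒≽ p with Suffix.toView p
... | t Suffix.++ eq = t , cong (t ++_) (sym (Pointwise-≡⇒≡ eq))

⊑⇒factor : {A : Set} {u w : Word A} → u ⊑ w → u isFactorOf w
⊑⇒factor (l , r , refl) = Infix.fromView (Infix.MkView l (≡⇒Pointwise-≡ refl) r)

factor⇒⊑ : {A : Set} {u w : Word A} → u isFactorOf w → u ⊑ w
factor⇒⊑ p with Infix.toView p
... | Infix.MkView l eq r = l , r , cong (λ z → l ++ z ++ r) (sym (Pointwise-≡⇒≡ eq))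

length-bound : {A : Set} (ws : List (Word A)) → ∃[ M ] (∀ {w} → w ∈ˡ ws → length w ≤ M)
length-bound []       = 0 , λ ()
length-bound (w ∷ ws) = let M , bound = length-bound ws in
  length w + M , λ { (here refl) → m≤m+n _ M
                   ; (there w∈)  → ≤-trans (bound w∈) (m≤n+m M (length w)) }

-- From the hypotheses to a decoding, and the conclusion

module _ {A B : Set} (finite : FiniteNonempty A) {S : WordSet A}
         (recurrent : UniformlyRecurrent S) (treeSet : TreeSet S)
         {Z : WordSet A} (finiteZ : Finite Z) (maximalZ : MaximalBifixCode S Z)
         {f : Word B → Word A} (coding : CodingMorphism Z f) where
  open UniformlyRecurrent recurrent using (nonempty; recurrence)
  open TreeSet treeSet
  open MaximalBifixCode maximalZ
  open CodingMorphism coding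
  private
    module Hom = MonoidMorphisms.IsMonoidHomomorphism isMonoidHomomorphism
    module P = PrefixCode (proj₁ bifix)
    module Q = SuffixCode (proj₂ bifix)

    codewords : List (Word A)
    codewords = proj₁ finiteZ

    Z⇒∈ : ∀ {z} → Z z → z ∈ˡ codewords
    Z⇒∈ = proj₁ (proj₂ finiteZ)

    ∈⇒Z : ∀ {z} → z ∈ˡ codewords → Z z
    ∈⇒Z = proj₂ (proj₂ finiteZ)

    M : ℕ
    M = proj₁ (length-bound codewords)

    Z-bounded : ∀ {z} → Z z → length z ≤ M
    Z-bounded z∈Z = proj₂ (length-bound codewords) (Z⇒∈ z∈Z)

    factor′ : ∀ {u w} → S w → u ⊑ w → S u
    factor′ Sw u⊑w = factorial Sw (⊑⇒factor u⊑w)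

    letter-≟ : DecidableEquality A
    letter-≟ = inj⇒≟ (↔⇒↣ (proj₂ finite))

    -- Letters of `B` are searched for through the finite list of codewords, onto which `f` maps
    -- them.
    existsLetter? : {Q : Word A → Set} → (∀ z → Dec (Q z)) → Dec (∃[ b ] Q (f [ b ]))
    existsLetter? {Q} Q? = map′ to from (any? Q? codewords)
      where
      to : Any Q codewords → ∃[ b ] Q (f [ b ])
      to p = let z , z∈ , Qz = find p
                 b , fb≡z    = lettersOnto (∈⇒Z z∈)
             in b , subst Q (sym fb≡z) Qz
      from : ∃[ b ] Q (f [ b ]) → Any Q codewords
      from (b , Qb) = lose (Z⇒∈ (lettersInto b)) Qb

    proper : ∀ {u v : Word A} {a s} → v ≡ u ++ a ∷ s → u ≢ v
    proper {u} v≡ refl = <-irrefl (cong length v≡) (nonempty⇒shorter u λ ())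

    comparable⇒≡ : ∀ {b b′} s → f [ b′ ] ≡ f [ b ] ++ s → b ≡ b′
    comparable⇒≡ {b} []      eq = lettersInjective (sym (trans eq (++-identityʳ (f [ b ]))))
    comparable⇒≡ {b} {b′} (a ∷ s) eq = contradiction (≼⇒prefix (a ∷ s , eq) , proper eq)
      (P.noProperPrefix (lettersInto b) (lettersInto b′))

    comparable⇒≡ˢ : ∀ {b b′} s → f [ b′ ] ≡ s ++ f [ b ] → b ≡ b′
    comparable⇒≡ˢ []      eq = lettersInjective (sym eq)
    comparable⇒≡ˢ {b} {b′} (a ∷ s) eq = contradiction
      (≽⇒suffix (a ∷ s , eq) , λ fb≡ → <-irrefl (cong length (trans fb≡ eq)) (s≤s (length-++-≤ʳ (f [ b ]) {s})))
      (Q.noProperSuffix (lettersInto b) (lettersInto b′))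

    code-prefixFree : ∀ {b b′ t t′} → f [ b ] ++ t ≡ f [ b′ ] ++ t′ → b ≡ b′
    code-prefixFree {b} {b′} eq with ≤-total (length (f [ b ])) (length (f [ b′ ]))
    ... | inj₁ le = let s , fb′≡ , _ = levi (f [ b ]) (f [ b′ ]) eq le in comparable⇒≡ s fb′≡
    ... | inj₂ ge = let s , fb≡ , _ = levi (f [ b′ ]) (f [ b ]) (sym eq) ge in sym (comparable⇒≡ s fb≡)

    code-suffixFree : ∀ {b b′ t t′} → t ++ f [ b ] ≡ t′ ++ f [ b′ ] → b ≡ b′
    code-suffixFree {t = t} {t′} eq with ≤-total (length t) (length t′)
    ... | inj₁ le = let s , _ , fb≡ = levi t t′ eq le in sym (comparable⇒≡ˢ s fb≡)
    ... | inj₂ ge = let s , _ , fb′≡ = levi t′ t (sym eq) ge in comparable⇒≡ˢ s fb′≡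

    starts-dec : ∀ w → Dec (∃[ b ] f [ b ] ≼ w)
    starts-dec w = existsLetter? λ z → map′ prefix⇒≼ ≼⇒prefix (prefix? letter-≟ z w)

    ends-dec : ∀ w → Dec (∃[ b ] f [ b ] ≽ w)
    ends-dec w = existsLetter? λ z → map′ suffix⇒≽ ≽⇒suffix (suffix? letter-≟ z w)

    module _ {w : Word A} (Sw : S w) (M<w : M < length w)
             (¬starts : ¬ (∃[ b ] f [ b ] ≼ w)) (¬ends : ¬ (∃[ b ] f [ b ] ≽ w)) where

      -- The larger code that contradicts maximality: `w` is too long to be a prefix or suffix of a
      -- codeword, and by assumption no codeword is a prefix or suffix of `w`.
      Z∪w : WordSet A
      Z∪w z = Z z ⊎ z ≡ w

      longer : ∀ {z} → Z z → ¬ (length w ≤ length z)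
      longer z∈Z w≤z = <⇒≱ M<w (≤-trans w≤z (Z-bounded z∈Z))

      nonemptyWords′ : ∀ {z} → Z∪w z → z ≢ []
      nonemptyWords′ (inj₁ z∈Z)  refl = P.nonemptyWords z∈Z refl
      nonemptyWords′ (inj₂ refl) refl = contradiction M<w λ ()

      noProperPrefix′ : ∀ {u z} → Z∪w u → Z∪w z → ¬ (u isProperPrefixOf z)
      noProperPrefix′ (inj₁ u∈Z)  (inj₁ z∈Z)  p       = P.noProperPrefix u∈Z z∈Z p
      noProperPrefix′ (inj₁ u∈Z)  (inj₂ refl) (p , _) with lettersOnto u∈Z
      ... | b , refl = ¬starts (b , prefix⇒≼ p)
      noProperPrefix′ (inj₂ refl) (inj₁ z∈Z)  (p , _) = longer z∈Z (Prefix.length-mono p)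
      noProperPrefix′ (inj₂ refl) (inj₂ refl) (_ , ≢) = ≢ refl

      noProperSuffix′ : ∀ {u z} → Z∪w u → Z∪w z → ¬ (u isProperSuffixOf z)
      noProperSuffix′ (inj₁ u∈Z)  (inj₁ z∈Z)  p       = Q.noProperSuffix u∈Z z∈Z p
      noProperSuffix′ (inj₁ u∈Z)  (inj₂ refl) (p , _) with lettersOnto u∈Z
      ... | b , refl = ¬ends (b , suffix⇒≽ p)
      noProperSuffix′ (inj₂ refl) (inj₁ z∈Z)  (p , _) = longer z∈Z (Suffix.length-mono p)
      noProperSuffix′ (inj₂ refl) (inj₂ refl) (_ , ≢) = ≢ refl

      extendable : ⊥
      extendable = maximal (Z∪w , (λ { (inj₁ z∈Z) → contained z∈Z ; (inj₂ refl) → Sw }) ,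
        (record { nonemptyWords = nonemptyWords′ ; noProperPrefix = noProperPrefix′ } ,
         record { nonemptyWords = nonemptyWords′ ; noProperSuffix = noProperSuffix′ }) ,
        inj₁ , λ Z∪w⊆Z → longer (Z∪w⊆Z (inj₂ refl)) ≤-refl)

    maximal′ : ∀ {w} → S w → M < length w → (∃[ b ] f [ b ] ≼ w) ⊎ (∃[ b ] f [ b ] ≽ w)
    maximal′ {w} Sw M<w with starts-dec w | ends-dec w
    ... | yes s  | _     = inj₁ s
    ... | no _   | yes e = inj₂ e
    ... | no ¬s  | no ¬e = ⊥-elim (extendable Sw M<w ¬s ¬e)

    decoding : Decoding S f M
    decoding = record
      { empty         = factor′ (proj₂ nonempty) (++ˡ⊑ [] _)
      ; factor        = factor′
      ; extendˡ       = λ {w} Sw → let a , b , Sawb = biextendable Sw in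
                        a , factor′ Sawb (++ˡ⊑ (a ∷ w) [ b ])
      ; extendʳ       = λ {w} Sw → let a , b , Sawb = biextendable Sw in
                        b , factor′ Sawb (++ʳ⊑ [ a ] (w ∷ʳ b))
      ; recurs        = recurs′
      ; f-[]          = Hom.ε-homo
      ; f-++          = Hom.homo
      ; code-nonempty = λ b → P.nonemptyWords (lettersInto b)
      ; code-bounded  = λ b → Z-bounded (lettersInto b)
      ; prefixFree    = code-prefixFree
      ; suffixFree    = λ {b} {b′} {t} {t′} → code-suffixFree {b} {b′} {t} {t′}
      ; starts?       = starts-dec
      ; ends?         = ends-dec
      ; maximal       = maximal′
      }
      where
      recurs′ : ∀ {u} → S u → ∃[ n ] (∀ {w} → S w → n ≤ length w → u ⊑ w)
      recurs′ Su with recurrence Su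
      ... | n , _ , occurs = n , λ {w} Sw n≤w →
        let v⊑w = ≼⇒⊑ (drop n w , sym (take++drop≡id n w))
        in ⊑-trans (factor⇒⊑ (occurs (factor′ Sw v⊑w) (trans (length-take n w) (m≤n⇒m⊓n≡m n≤w)))) v⊑w

    open Decoding decoding using (f-++)
    open TwoSided decoding

    decoding-tree : ∀ {w} → S (f w) → IsTree (extensionGraph (f ⊢ S) w)
    decoding-tree {w} Sfw = EdgeConnected⇒connected left-edge right-edge
        (decoding-EdgeConnected letter-≟ S-connected w) ,
      Forest⇒acyclic (decoding-Forest letter-≟ S-forest w)
      where
      middle⊑ : ∀ v {a b : A} → v ⊑ a ∷ v ∷ʳ b
      middle⊑ v {a} {b} = [ a ] , [ b ] , refl
      -- Here `v` need not be in `S`; any edge of its graph puts it there, which is what `tree` asks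
      -- for.
      S-forest : ∀ v → Forest (E S v)
      S-forest v t =
        acyclic⇒Forest (proj₂ (tree (factor′ (firstEdge t) (middle⊑ v)))) t
      S-connected : ∀ v → EdgeConnected (E S v)
      S-connected v e = connected⇒EdgeConnected (λ {a} {b} e → factor′ e (++ʳ⊑ [ a ] (v ∷ʳ b)))
        (proj₁ (tree (factor′ e (middle⊑ v)))) e
      left-edge : ∀ {a} → S (f (a ∷ w)) → ∃[ b ] S (f (a ∷ w ∷ʳ b))
      left-edge {a} Saw = let b , Sawb = appendCodeword Saw in
        b , subst S (sym (f-++ (a ∷ w) [ b ])) Sawb
      right-edge : ∀ {b} → S (f (w ∷ʳ b)) → ∃[ a ] S (f (a ∷ w ∷ʳ b))
      right-edge {b} Swb = let a , Sawb = prependCodeword Swb in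
        a , subst S (sym (f-∷ a (w ∷ʳ b))) Sawb

    open Recurrence decoding (λ Sfw → proj₁ (decoding-tree Sfw))

    decoding-factorial : Factorial (f ⊢ S)
    decoding-factorial Sfw u⊑w = decoding-factor Sfw (factor⇒⊑ u⊑w)

  decoding-UniformlyRecurrent : UniformlyRecurrent (f ⊢ S)
  decoding-UniformlyRecurrent = record
    { nonempty        = [] , subst S (sym Hom.ε-homo) (Decoding.empty decoding)
    ; factorial       = decoding-factorial
    ; rightExtendable = decoding-extendʳ
    ; recurrence      = λ Sfu → let n , occurs = decoding-recurs Sfu in
        -- The successor ensures that the length is at least one.
        suc n , s≤s z≤n , λ Sfw len → ⊑⇒factor (occurs Sfw (<⇒≤ (≤-reflexive (sym len))))
    }

  decoding-TreeSet : TreeSet (f ⊢ S)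
  decoding-TreeSet = record
    { factorial    = decoding-factorial
    ; biextendable = biextend
    ; tree         = decoding-tree
    }
    where
    biextend : Biextendable (f ⊢ S)
    biextend {w} Sfw = let b , Swb  = decoding-extendʳ Sfw
                           a , Sawb = prependCodeword Swb
                       in a , b , subst S (sym (f-∷ a (w ∷ʳ b))) Sawb

theorem6p1 : {A B : Set} → FiniteNonempty A →
    (S : WordSet A) → UniformlyRecurrent S → TreeSet S →
    (Z : WordSet A) → Finite Z → MaximalBifixCode S Z →
    (f : Word B → Word A) → CodingMorphism Z f →
    UniformlyRecurrent (f ⊢ S) × TreeSet (f ⊢ S)
theorem6p1 finite S recurrent treeSet Z finiteZ maximalZ f coding =
  decoding-UniformlyRecurrent finite recurrent treeSet finiteZ maximalZ coding ,
  decoding-TreeSet finite recurrent treeSet finiteZ maximalZ coding
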